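{- Let $k\geq 1$ be an integer, let $s_2,s_3,\dots$ be non-negative integers, only finitely many of which are non-zero, and let $(\sigma_1,\sigma_2,q)$ be a triple such that: (a) $\sigma_1,\sigma_2\in\mathfrak{S}(k)$ and $\sigma_1\circ\sigma_2=(1,2,\dots,k)$; (b) $|C(\sigma_2)|=s_2+s_3+\cdots$; (c) $|C(\sigma_1)|+|C(\sigma_2)|=2s_2+3s_3+4s_4+\cdots$; (d) $q:C(\sigma_2)\rightarrow\{2,3,\dots\}$ is a map taking each value $i\in\{2,3,\dots\}$ exactly $s_i$ times. Then the condition (e) for every set $A\subset C(\sigma_2)$ with $A\neq\emptyset$ and $A\neq C(\sigma_2)$ there are more than $\sum_{i\in A}\big(q(i)-1\big)$ cycles of $\sigma_1$ which intersect $\bigcup A$ is equivalent to each of the following two conditions: (e$^2$) for every set $A\subset C(\sigma_2)$ with $A\neq\emptyset$ and $A\neq C(\sigma_2)$ there exist two arrangements of marriages $\mathcal{M}_1,\mathcal{M}_2:C(\sigma_1)\rightarrow C(\sigma_2)$ such that $\mathcal{M}_1^{ -1}(A)\neq\mathcal{M}_2^{ -1}(A)$; (e$^3$) there exists a strictly positive solution (all $x_{i,j}>0$) of the following system of equations in the variables $\{x_{i,j}: i\in C(\sigma_1)\text{ and } j\in C(\sigma_2)\text{ are intersecting cycles}\}$: $$\forall\, i\in C(\sigma_1):\ \sum_j x_{i,j}=1,\qquad \forall\, j\in C(\sigma_2):\ \sum_i x_{i,j}=q(j)-1,$$ where the sums run over those indices for which the variable $x_{i,j}$ is defined.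
   Context: $\mathfrak{S}(k)$ is the symmetric group on $\{1,\dots,k\}$. For a permutation $\pi$, $C(\pi)$ is the set of cycles of $\pi$ (fixed points count as cycles), each regarded as the set of elements it acts on; cycles intersect if they share an element, $\bigcup A$ is the union of the cycles in $A$, and a cycle intersects $\bigcup A$ if it shares an element with it. An arrangement of marriages is a map $\mathcal{M}:C(\sigma_1)\rightarrow C(\sigma_2)$ such that for each $i\in C(\sigma_1)$ the cycles $i$ and $\mathcal{M}(i)$ intersect, and for each $j\in C(\sigma_2)$ one has $|\mathcal{M}^{ -1}(j)|=q(j)-1$. (Cycles of $\sigma_1$ are "boys", cycles of $\sigma_2$ are "girls", and $q(j)-1$ is the desired number of husbands of $j$.) -}

module Defs where

open import Data.Bool.Properties using () renaming (_≟_ to _≟ᵇ_)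
open import Data.Fin using (Fin; toℕ)
open import Data.Fin.Permutation using (Permutation′; _⟨$⟩ʳ_; _∘ₚ_)
open import Data.Fin.Subset
  using (Subset; ⊥; ⊤; ⁅_⁆; _∩_; ⋃; ∣_∣; Nonempty)
open import Data.Fin.Subset.Properties using (_∈?_; nonempty?)
open import Data.Integer using (+_)
open import Data.List
  using (List; map; filter; allFin; iterate; deduplicate; length; lookup;
         foldr; applyUpTo)
open import Data.Nat as ℕ using (ℕ; suc; _≤_; _<_; _⊔_; _∸_; NonZero)
open import Data.Nat.DivMod using (_%_)
open import Data.Nat.ListAction using (sum)
import Data.Nat.Properties as ℕₚ
open import Data.Product using (_×_; _,_; ∃; ∃₂; ∃-syntax)
open import Data.Rational as ℚ using (ℚ; 0ℚ; ½)
import Data.Rational.Properties as ℚₚ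
open import Data.Vec using (tabulate)
open import Data.Vec.Properties using (≡-dec)
open import Relation.Binary.Definitions using (DecidableEquality)
open import Relation.Binary.PropositionalEquality
open import Relation.Nullary using (Dec; does)
open import Relation.Unary using (Pred; Decidable)

import Algebra.Bundles as Bundles
import Algebra.Properties.CommutativeSemigroup as CommutativeSemigroupProperties
open Bundles.CommutativeMonoid ℚₚ.+-0-commutativeMonoid
  using (commutativeSemigroup)
open CommutativeSemigroupProperties commutativeSemigroup using (interchange)

private
  variable
    m n k : ℕ

⟦_⟧ : ∀ {p} {P : Pred (Fin n) p} → Decidable P → Subset n
⟦ P? ⟧ = tabulate λ i → does (P? i)

elements : Subset n → List (Fin n)
elements A = filter (_∈? A) (allFin _)

preimage : (Fin m → Fin n) → Subset n → Subset m
preimage f A = ⟦ (λ i → f i ∈? A) ⟧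

_≟ˢ_ : DecidableEquality (Subset n)
_≟ˢ_ = ≡-dec _≟ᵇ_

-- Σ[2+ N ] f is f(2) + f(3) + ⋯ + f(N+1).

Σ[2+_] : ℕ → (ℕ → ℕ) → ℕ
Σ[2+ N ] f = sum (applyUpTo (λ i → f (2 ℕ.+ i)) N)

-- Functional composition: σ₂ is applied first.

infixr 9 _∘ᵖ_
_∘ᵖ_ : Permutation′ k → Permutation′ k → Permutation′ k
σ₁ ∘ᵖ σ₂ = σ₂ ∘ₚ σ₁

-- The permutation (1, 2, …, k), with the element a ∈ {1, …, k}
-- represented by the index a - 1.

IsLongCycle : .{{_ : NonZero k}} → Permutation′ k → Set
IsLongCycle {k} π = ∀ a → toℕ (π ⟨$⟩ʳ a) ≡ suc (toℕ a) % k

-- {a, π(a), …, πᵏ⁻¹(a)}: no cycle has more than k elements.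

cycleOf : Permutation′ k → Fin k → Subset k
cycleOf {k} π a = ⋃ (map ⁅_⁆ (iterate (π ⟨$⟩ʳ_) a k))

-- C(π), listed without repetition.  Cycles of π are referred to below
-- by their positions in this list.

cycles : Permutation′ k → List (Subset k)
cycles π = deduplicate _≟ˢ_ (map (cycleOf π) (allFin _))

∣C_∣ : Permutation′ k → ℕ
∣C π ∣ = length (cycles π)

C : Permutation′ k → Set
C π = Fin ∣C π ∣

support : (π : Permutation′ k) → C π → Subset k
support π = lookup (cycles π)

⋃C : (π : Permutation′ k) → Subset ∣C π ∣ → Subset k
⋃C π A = ⋃ (map (support π) (elements A))

-- Real numbers as Cauchy sequences of rationals up to null sequences.

IsCauchy : (ℕ → ℚ) → Set
IsCauchy x = ∀ ε → 0ℚ ℚ.< ε →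
  ∃[ N ] ∀ m n → N ≤ m → N ≤ n → ℚ.∣ x m ℚ.- x n ∣ ℚ.< ε

record ℝ : Set where
  field
    approx : ℕ → ℚ
    cauchy : IsCauchy approx

open ℝ public

infix 4 _≈_
_≈_ : ℝ → ℝ → Set
x ≈ y = ∀ ε → 0ℚ ℚ.< ε →
  ∃[ N ] ∀ n → N ≤ n → ℚ.∣ approx x n ℚ.- approx y n ∣ ℚ.< ε

-- A positive real is eventually bounded away from 0; being eventually
-- positive is not enough.

Positive : ℝ → Set
Positive x = ∃[ ε ] 0ℚ ℚ.< ε × ∃[ N ] ∀ n → N ≤ n → ε ℚ.< approx x n

fromℚ : ℚ → ℝ
approx (fromℚ p) _ = p
cauchy (fromℚ p) ε 0<ε =
  0 , λ _ _ _ _ → subst (λ d → ℚ.∣ d ∣ ℚ.< ε) (sym (ℚₚ.+-inverseʳ p)) 0<ε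

fromℕ : ℕ → ℝ
fromℕ n = fromℚ (+ n ℚ./ 1)

private
  half-positive : ∀ ε → 0ℚ ℚ.< ε → 0ℚ ℚ.< ε ℚ.* ½
  half-positive ε 0<ε =
    subst (ℚ._< ε ℚ.* ½) (ℚₚ.*-zeroˡ ½) (ℚₚ.*-monoˡ-<-pos ½ 0<ε)

  half+half : ∀ ε → ε ℚ.* ½ ℚ.+ ε ℚ.* ½ ≡ ε
  half+half ε = trans (sym (ℚₚ.*-distribˡ-+ ε ½ ½)) (ℚₚ.*-identityʳ ε)

  ∣a+b-[c+d]∣≤ : ∀ a b c d →
    ℚ.∣ (a ℚ.+ b) ℚ.- (c ℚ.+ d) ∣ ℚ.≤ ℚ.∣ a ℚ.- c ∣ ℚ.+ ℚ.∣ b ℚ.- d ∣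
  ∣a+b-[c+d]∣≤ a b c d = begin
    ℚ.∣ (a ℚ.+ b) ℚ.- (c ℚ.+ d) ∣
      ≡⟨ cong (λ e → ℚ.∣ a ℚ.+ b ℚ.+ e ∣) (ℚₚ.neg-distrib-+ c d) ⟩
    ℚ.∣ (a ℚ.+ b) ℚ.+ (ℚ.- c ℚ.+ ℚ.- d) ∣
      ≡⟨ cong ℚ.∣_∣ (interchange a b (ℚ.- c) (ℚ.- d)) ⟩
    ℚ.∣ (a ℚ.- c) ℚ.+ (b ℚ.- d) ∣
      ≤⟨ ℚₚ.∣p+q∣≤∣p∣+∣q∣ (a ℚ.- c) (b ℚ.- d) ⟩
    ℚ.∣ a ℚ.- c ∣ ℚ.+ ℚ.∣ b ℚ.- d ∣ ∎
    where open ℚₚ.≤-Reasoning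

infixl 6 _+ℝ_
_+ℝ_ : ℝ → ℝ → ℝ
approx (x +ℝ y) n = approx x n ℚ.+ approx y n
cauchy (x +ℝ y) ε 0<ε
  with M , x-close ← cauchy x (ε ℚ.* ½) (half-positive ε 0<ε)
     | N , y-close ← cauchy y (ε ℚ.* ½) (half-positive ε 0<ε)
  = M ⊔ N , λ m n M⊔N≤m M⊔N≤n → begin-strict
      ℚ.∣ (approx x m ℚ.+ approx y m) ℚ.- (approx x n ℚ.+ approx y n) ∣
        ≤⟨ ∣a+b-[c+d]∣≤ (approx x m) (approx y m) (approx x n) (approx y n) ⟩
      ℚ.∣ approx x m ℚ.- approx x n ∣ ℚ.+ ℚ.∣ approx y m ℚ.- approx y n ∣
        <⟨ ℚₚ.+-mono-<
             (x-close m n (ℕₚ.m⊔n≤o⇒m≤o M N M⊔N≤m) (ℕₚ.m⊔n≤o⇒m≤o M N M⊔N≤n))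
             (y-close m n (ℕₚ.m⊔n≤o⇒n≤o M N M⊔N≤m) (ℕₚ.m⊔n≤o⇒n≤o M N M⊔N≤n)) ⟩
      ε ℚ.* ½ ℚ.+ ε ℚ.* ½
        ≡⟨ half+half ε ⟩
      ε ∎
  where open ℚₚ.≤-Reasoning

sumℝ : List ℝ → ℝ
sumℝ = foldr _+ℝ_ (fromℕ 0)

module _ (σ₁ σ₂ : Permutation′ k) where

  Intersect : C σ₁ → C σ₂ → Set
  Intersect i j = Nonempty (support σ₁ i ∩ support σ₂ j)

  intersect? : ∀ i j → Dec (Intersect i j)
  intersect? i j = nonempty? (support σ₁ i ∩ support σ₂ j)

  boysMeeting : Subset ∣C σ₂ ∣ → Subset ∣C σ₁ ∣
  boysMeeting A = ⟦ (λ i → nonempty? (support σ₁ i ∩ ⋃C σ₂ A)) ⟧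

  module _ (q : C σ₂ → ℕ) where

    record IsArrangement (M : C σ₁ → C σ₂) : Set where
      field
        intersecting : ∀ i → Intersect i (M i)
        husbands     : ∀ j → ∣ preimage M ⁅ j ⁆ ∣ ≡ q j ∸ 1

    Condition-e : Set
    Condition-e = ∀ (A : Subset ∣C σ₂ ∣) → A ≢ ⊥ → A ≢ ⊤ →
      sum (map (λ j → q j ∸ 1) (elements A)) < ∣ boysMeeting A ∣

    Condition-e² : Set
    Condition-e² = ∀ (A : Subset ∣C σ₂ ∣) → A ≢ ⊥ → A ≢ ⊤ →
      ∃₂ λ M₁ M₂ → IsArrangement M₁ × IsArrangement M₂ ×
                   preimage M₁ A ≢ preimage M₂ A

    -- Only the values x i j at intersecting i and j are variables of
    -- the system; the other values of x are unconstrained and unused.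

    record IsPositiveSolution (x : C σ₁ → C σ₂ → ℝ) : Set where
      field
        positive : ∀ i j → Intersect i j → Positive (x i j)
        rows     : ∀ i →
          sumℝ (map (x i) (elements ⟦ intersect? i ⟧)) ≈ fromℕ 1
        columns  : ∀ j →
          sumℝ (map (λ i → x i j) (elements ⟦ (λ i → intersect? i j) ⟧))
            ≈ fromℕ (q j ∸ 1)

    Condition-e³ : Set
    Condition-e³ = ∃ IsPositiveSolution

{-# OPTIONS --safe #-}
module Submission where

-- (e) is Hall's condition with strict inequality.  Strictness leaves room to prescribe
-- one marriage i ↦ j and still satisfy Hall's condition, so through every pair of
-- intersecting cycles there is an arrangement.  Two arrangements as in (e²) are then
-- found through a cycle which meets ⋃ A but is not married into A, and averaging
-- arrangements solves (e³).  Conversely, two different preimages of A have the size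
-- Σ (q − 1) and lie among the cycles meeting ⋃ A, so neither of these is all of them; and
-- summing (e³) over A gives (e) without strictness, which is gained from a positive
-- x i j with i meeting ⋃ A and j ∉ A: such a pair exists because σ₁ and σ₂ generate
-- a transitive group.

open import Defs
open import Data.Nat using (ℕ; NonZero; _+_; _*_; _≤_; _≟_)
open import Data.Fin.Permutation using (Permutation′)
open import Data.Fin.Subset using (∣_∣)
open import Data.Product using (_×_)
open import Function.Bundles using (_⇔_)
open import Relation.Binary.PropositionalEquality using (_≡_)

open import Data.Bool using (true; false; if_then_else_; _∨_; _∧_)
open import Data.Empty using (⊥-elim)
open import Data.Fin as Fin using (Fin; zero; suc; toℕ)
open import Data.Fin.Permutation using (_⟨$⟩ʳ_; _⟨$⟩ˡ_; inverseˡ)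
import Data.Fin.Properties as Finₚ
open import Data.Fin.Subset hiding (∣_∣)
open import Data.Fin.Subset.Induction using (⊂-wellFounded)
open import Data.Fin.Subset.Properties
import Data.Integer as ℤ
import Data.Integer.Properties as ℤₚ
open import Data.List as List using (List; []; _∷_; allFin)
import Data.List.Membership.Propositional as ListMem
import Data.List.Membership.Propositional.Properties as ListMemₚ
import Data.List.Relation.Unary.All as All
open import Data.List.Relation.Unary.AllPairs using (_∷_)
open import Data.List.Relation.Unary.Any as Any using (Any; here; there)
import Data.List.Relation.Unary.Any.Properties as Anyₚ
open import Data.List.Relation.Unary.Unique.DecPropositional.Properties using (deduplicate-!)
open import Data.List.Relation.Unary.Unique.Propositional using (Unique)
open import Data.Nat as ℕ using (zero; suc; _∸_; _<_; _⊔_; s≤s; z≤n)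
open import Data.Nat.Coprimality using (1-coprimeTo) renaming (sym to coprime-sym)
open import Data.Nat.DivMod
  using (_%_; _/_; m≡m%n+[m/n]*n; m%n<n; m%n%n≡m%n; %-distribˡ-+; [m+n]%n≡m%n; m<n⇒m%n≡m)
open import Data.Nat.GeneralisedArithmetic using (iterate)
open import Data.Nat.ListAction using () renaming (sum to sumᴸ)
import Data.Nat.Properties as ℕₚ
open import Data.Product using (_,_; ∃₂; ∃-syntax; proj₁; proj₂)
open import Data.Rational as ℚ using (ℚ; 0ℚ; 1ℚ; mkℚ)
import Data.Rational.Properties as ℚₚ
open import Data.Sum using (inj₁; inj₂)
open import Data.Vec as Vec using ([]; _∷_)
import Data.Vec.Functional as Vector
open import Data.Vec.Functional.Properties using (updateAt-updates; updateAt-minimal)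
import Data.Vec.Properties as Vecₚ
open import Function using (_∘_; const; case_of_)
open import Function.Bundles using (mk⇔)
open import Induction.WellFounded using (Acc; acc)
open import Relation.Binary.PropositionalEquality hiding (_≡_)
open import Relation.Nullary
open import Relation.Nullary.Decidable using (dec-true; dec-false)
open import Relation.Unary using (Pred; Decidable)

open import Algebra.Properties.Group ℚₚ.+-0-group using (⁻¹-anti-homo-//)
open import Algebra.Properties.Semiring.Sum ℕₚ.+-*-semiring
  using (sum; sum-syntax; sum-cong-≗; ∑-distrib-+; ∑-comm; sum-replicate-zero;
         *-distribˡ-sum)
import Algebra.Properties.CommutativeMonoid.Sum ℚₚ.+-0-commutativeMonoid as ℚΣ

-- By (c) and (d) the girls together want exactly |C(σ₁)| husbands. Hence Hall's inequality is an
-- equality for the set of all girls, which is why (e) must exclude that set, and lower bounds on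
-- the sizes of all preimages already determine these sizes.
--
-- Without strictness a prescribed marriage i ↦ j may destroy Hall's condition, so Hall's theorem
-- itself has to search for a suitable j. Both situations are governed by the same obstruction: a
-- set of girls that satisfies Hall's inequality with equality, is met by i and does not contain j.
--
-- The obstacle in (e³) is that a real number is a Cauchy sequence, so that the equations hold only
-- in the limit. All entries are therefore read off at one late index, where they are rational and
-- every equation holds up to an error δ. The gain from the pair with j ∉ A is bounded below by a
-- rational ε, so it survives as soon as (|C(σ₁)| + |C(σ₂)|) δ < ε.

private variable
  k m n : ℕ

-- Cycles

∈-⋃⁺ : ∀ {x : Fin n} {As} → Any (x ∈_) As → x ∈ ⋃ As
∈-⋃⁺ (here x∈A)   = x∈p∪q⁺ (inj₁ x∈A)
∈-⋃⁺ (there x∈As) = x∈p∪q⁺ (inj₂ (∈-⋃⁺ x∈As))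

∈-⋃⁻ : ∀ {x : Fin n} As → x ∈ ⋃ As → Any (x ∈_) As
∈-⋃⁻ []       x∈⊥ = ⊥-elim (∉⊥ x∈⊥)
∈-⋃⁻ (A ∷ As) x∈  with x∈p∪q⁻ A (⋃ As) x∈
... | inj₁ x∈A  = here x∈A
... | inj₂ x∈As = there (∈-⋃⁻ As x∈As)

module _ {a} {A : Set a} (f : A → A) where

  iterate-+ : ∀ x m n → iterate f x (m + n) ≡ iterate f (iterate f x m) n
  iterate-+ x zero    n = refl
  iterate-+ x (suc m) n = iterate-+ (f x) m n

  iterate-injective : (∀ {x y} → f x ≡ f y → x ≡ y) →
    ∀ n {x y} → iterate f x n ≡ iterate f y n → x ≡ y
  iterate-injective f-inj zero    eq = eq
  iterate-injective f-inj (suc n) eq = f-inj (iterate-injective f-inj n eq)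

  iterate-period : ∀ {x} p → iterate f x p ≡ x → ∀ m → iterate f x (m * p) ≡ x
  iterate-period p eq zero    = refl
  iterate-period {x} p eq (suc m) = trans (iterate-+ x p (m * p))
    (trans (cong (λ y → iterate f y (m * p)) eq) (iterate-period p eq m))

  ∈-iterate⁻ : ∀ {x y} n → y ListMem.∈ List.iterate f x n →
    ∃[ t ] iterate f x t ≡ y
  ∈-iterate⁻ (suc n) (here refl) = 0 , refl
  ∈-iterate⁻ (suc n) (there y∈) with t , eq ← ∈-iterate⁻ n y∈ = suc t , eq

  ∈-iterate⁺ : ∀ {x n t} → t < n → iterate f x t ListMem.∈ List.iterate f x n
  ∈-iterate⁺ {t = zero}  (s≤s _)   = here refl
  ∈-iterate⁺ {t = suc t} (s≤s t<n) = there (∈-iterate⁺ t<n)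

Unique-lookup-injective : ∀ {a} {A : Set a} {xs : List A} → Unique xs →
  ∀ {i j} → List.lookup xs i ≡ List.lookup xs j → i ≡ j
Unique-lookup-injective (x∉xs ∷ u) {zero}  {zero}  eq = refl
Unique-lookup-injective (x∉xs ∷ u) {zero}  {suc j} eq =
  contradiction eq (All.lookup x∉xs (ListMemₚ.∈-lookup j))
Unique-lookup-injective (x∉xs ∷ u) {suc i} {zero}  eq =
  contradiction (sym eq) (All.lookup x∉xs (ListMemₚ.∈-lookup i))
Unique-lookup-injective (x∉xs ∷ u) {suc i} {suc j} eq =
  cong suc (Unique-lookup-injective u eq)

module _ (π : Permutation′ k) where

  private
    _^_·_ : Permutation′ k → ℕ → Fin k → Fin k
    π ^ t · a = iterate (π ⟨$⟩ʳ_) a t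

  ⟨$⟩ʳ-injective : ∀ {a b} → π ⟨$⟩ʳ a ≡ π ⟨$⟩ʳ b → a ≡ b
  ⟨$⟩ʳ-injective eq =
    trans (sym (inverseˡ π)) (trans (cong (π ⟨$⟩ˡ_) eq) (inverseˡ π))

  -- Among the iterates with exponents 0, ..., k two agree by the pigeonhole principle, and
  -- injectivity cancels the smaller exponent. The bound by k matters because `cycleOf` lists only k
  -- iterates.
  period : ∀ a → ∃[ p ] suc p ≤ k × π ^ suc p · a ≡ a
  period a
    with i , j , i<j , eq ←
           Finₚ.pigeonhole (ℕₚ.n<1+n k) (λ (t : Fin (suc k)) → π ^ toℕ t · a)
    with d , 1+i+d≡j ← ℕₚ.m≤n⇒∃[o]m+o≡n i<j
    = d
    , ℕₚ.≤-trans (ℕₚ.≤-trans (s≤s (ℕₚ.m≤n+m d (toℕ i))) (ℕₚ.≤-reflexive 1+i+d≡j))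
                 (Finₚ.toℕ≤pred[n] j)
    , iterate-injective (π ⟨$⟩ʳ_) ⟨$⟩ʳ-injective (toℕ i) (begin
        π ^ toℕ i · (π ^ suc d · a) ≡⟨ iterate-+ (π ⟨$⟩ʳ_) a (suc d) (toℕ i) ⟨
        π ^ suc d + toℕ i · a       ≡⟨ cong (π ^_· a) (cong suc (ℕₚ.+-comm d (toℕ i))) ⟩
        π ^ suc (toℕ i + d) · a     ≡⟨ cong (π ^_· a) 1+i+d≡j ⟩
        π ^ toℕ j · a               ≡⟨ eq ⟨
        π ^ toℕ i · a               ∎)
    where open ≡-Reasoning

  ∈-cycleOf⁻ : ∀ {a b} → b ∈ cycleOf π a → ∃[ t ] π ^ t · a ≡ b
  ∈-cycleOf⁻ {a} {b} b∈ = ∈-iterate⁻ (π ⟨$⟩ʳ_) k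
    (Any.map (λ b∈⁅x⁆ → x∈⁅y⁆⇒x≡y _ b∈⁅x⁆) (Anyₚ.map⁻ (∈-⋃⁻ _ b∈)))

  -- Reducing t modulo the period brings the exponent below k, into the range that `cycleOf` lists.
  ∈-cycleOf⁺ : ∀ a t → π ^ t · a ∈ cycleOf π a
  ∈-cycleOf⁺ a t with p , p<k , eq ← period a =
    ∈-⋃⁺ (Anyₚ.map⁺ (Any.map (λ { refl → subst (_∈ ⁅ π ^ t % suc p · a ⁆) reduce (x∈⁅x⁆ _) })
      (∈-iterate⁺ (π ⟨$⟩ʳ_) (ℕₚ.<-≤-trans (m%n<n t (suc p)) p<k))))
    where
    open ≡-Reasoning
    reduce : π ^ t % suc p · a ≡ π ^ t · a
    reduce = begin
      π ^ t % suc p · a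
        ≡⟨ cong (π ^ t % suc p ·_) (iterate-period (π ⟨$⟩ʳ_) (suc p) eq (t / suc p)) ⟨
      π ^ t % suc p · (π ^ t / suc p * suc p · a)
        ≡⟨ iterate-+ (π ⟨$⟩ʳ_) a (t / suc p * suc p) (t % suc p) ⟨
      π ^ t / suc p * suc p + t % suc p · a
        ≡⟨ cong (π ^_· a) (ℕₚ.+-comm (t / suc p * suc p) (t % suc p)) ⟩
      π ^ t % suc p + t / suc p * suc p · a
        ≡⟨ cong (π ^_· a) (m≡m%n+[m/n]*n t (suc p)) ⟨
      π ^ t · a ∎

  self∈cycleOf : ∀ a → a ∈ cycleOf π a
  self∈cycleOf a = ∈-cycleOf⁺ a 0

  cycleOf-trans : ∀ {a b} → b ∈ cycleOf π a → cycleOf π b ⊆ cycleOf π a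
  cycleOf-trans {a} b∈ c∈
    with t , refl ← ∈-cycleOf⁻ b∈ | u , refl ← ∈-cycleOf⁻ c∈
    = subst (_∈ cycleOf π a) (iterate-+ (π ⟨$⟩ʳ_) a t u) (∈-cycleOf⁺ a (t + u))

  cycleOf-sym : ∀ {a b} → b ∈ cycleOf π a → a ∈ cycleOf π b
  cycleOf-sym {a} b∈ with t , refl ← ∈-cycleOf⁻ b∈ | p , _ , eq ← period a =
    -- The way back to a goes forwards: t * p further steps complete t full periods of length
    -- `suc p`.
    subst (_∈ cycleOf π (π ^ t · a)) (begin
      π ^ t * p · (π ^ t · a) ≡⟨ iterate-+ (π ⟨$⟩ʳ_) a t (t * p) ⟨
      π ^ t + t * p · a       ≡⟨ cong (π ^_· a) (ℕₚ.*-suc t p) ⟨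
      π ^ t * suc p · a       ≡⟨ iterate-period (π ⟨$⟩ʳ_) (suc p) eq t ⟩
      a                       ∎)
      (∈-cycleOf⁺ (π ^ t · a) (t * p))
    where open ≡-Reasoning

  cycleOf-cong : ∀ {a b} → b ∈ cycleOf π a → cycleOf π b ≡ cycleOf π a
  cycleOf-cong b∈ = ⊆-antisym (cycleOf-trans b∈) (cycleOf-trans (cycleOf-sym b∈))

  private
    cycleOf∈cycles : ∀ a → cycleOf π a ListMem.∈ cycles π
    cycleOf∈cycles a = ListMemₚ.∈-deduplicate⁺ _≟ˢ_
      (ListMemₚ.∈-map⁺ (cycleOf π) (ListMemₚ.∈-allFin a))

  cycleThrough : Fin k → C π
  cycleThrough a = Any.index (cycleOf∈cycles a)

  support-cycleThrough : ∀ a → support π (cycleThrough a) ≡ cycleOf π a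
  support-cycleThrough a = sym (Anyₚ.lookup-index (cycleOf∈cycles a))

  support≡cycleOf : ∀ i → ∃[ a ] support π i ≡ cycleOf π a
  support≡cycleOf i
    with a , _ , eq ← ListMemₚ.∈-map⁻ (cycleOf π)
           (ListMemₚ.∈-deduplicate⁻ _≟ˢ_ (List.map (cycleOf π) (allFin k)) (ListMemₚ.∈-lookup i))
    = a , eq

  support-nonempty : ∀ i → Nonempty (support π i)
  support-nonempty i with a , eq ← support≡cycleOf i =
    a , subst (a ∈_) (sym eq) (self∈cycleOf a)

  ∈-cycleThrough : ∀ a → a ∈ support π (cycleThrough a)
  ∈-cycleThrough a = subst (a ∈_) (sym (support-cycleThrough a)) (self∈cycleOf a)

  -- The support is determined by any of its points, and `deduplicate` leaves each support at a
  -- single position of `cycles π`.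
  cycleThrough-unique : ∀ {a i} → a ∈ support π i → i ≡ cycleThrough a
  cycleThrough-unique {a} {i} a∈i with b , eq ← support≡cycleOf i =
    Unique-lookup-injective (deduplicate-! _≟ˢ_ (List.map (cycleOf π) (allFin k)))
      (trans eq (sym (trans (support-cycleThrough a)
        (cycleOf-cong (subst (a ∈_) eq a∈i)))))

  support-closed : ∀ {a i} → a ∈ support π i → π ⟨$⟩ʳ a ∈ support π i
  support-closed {a} {i} a∈i with b , eq ← support≡cycleOf i =
    subst (π ⟨$⟩ʳ a ∈_) (sym eq)
      (cycleOf-trans (subst (a ∈_) eq a∈i) (∈-cycleOf⁺ a 1))

-- Hall's theorem

does-∈? : ∀ (i : Fin n) A → does (i ∈? A) ≡ Vec.lookup A i
does-∈? zero    (inside  ∷ A) = refl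
does-∈? zero    (outside ∷ A) = refl
does-∈? (suc i) (x ∷ A)       = does-∈? i A

module _ {p} {P : Pred (Fin n) p} (P? : Decidable P) where

  ∈-⟦⟧⁺ : ∀ {i} → P i → i ∈ ⟦ P? ⟧
  ∈-⟦⟧⁺ {i} Pi = Vecₚ.lookup⇒[]= i _
    (trans (Vecₚ.lookup∘tabulate (λ i → does (P? i)) i) (dec-true (P? i) Pi))

  ∈-⟦⟧⁻ : ∀ {i} → i ∈ ⟦ P? ⟧ → P i
  ∈-⟦⟧⁻ {i} i∈ with P? i
    | trans (sym (Vecₚ.lookup∘tabulate (λ i → does (P? i)) i)) (Vecₚ.[]=⇒lookup i∈)
  ... | yes Pi | _ = Pi

⟦⟧-cong : ∀ {p q} {P : Pred (Fin n) p} {Q : Pred (Fin n) q}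
  {P? : Decidable P} {Q? : Decidable Q} →
  (∀ {i} → P i → Q i) → (∀ {i} → Q i → P i) → ⟦ P? ⟧ ≡ ⟦ Q? ⟧
⟦⟧-cong {P? = P?} {Q?} P⇒Q Q⇒P =
  ⊆-antisym (∈-⟦⟧⁺ Q? ∘ P⇒Q ∘ ∈-⟦⟧⁻ P?) (∈-⟦⟧⁺ P? ∘ Q⇒P ∘ ∈-⟦⟧⁻ Q?)

∣⟦⟧∣ : ∀ {p} {P : Pred (Fin n) p} (P? : Decidable P) →
  ∣ ⟦ P? ⟧ ∣ ≡ ∑[ i < n ] (if does (P? i) then 1 else 0)
∣⟦⟧∣ {zero}  P? = refl
∣⟦⟧∣ {suc n} P? with does (P? zero)
... | true  = cong suc (∣⟦⟧∣ (P? ∘ suc))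
... | false = ∣⟦⟧∣ (P? ∘ suc)

⊆∧≢⇒⊂ : {A B : Subset n} → A ⊆ B → A ≢ B → A ⊂ B
⊆∧≢⇒⊂ {A = A} {B} A⊆B A≢B with Finₚ.any? (λ i → (i ∈? B) ×-dec ¬? (i ∈? A))
... | yes (i , i∈B , i∉A) = A⊆B , i , i∈B , i∉A
... | no ∄ = contradiction (⊆-antisym A⊆B
  (λ {i} i∈B → decidable-stable (i ∈? A) (λ i∉A → ∄ (i , i∈B , i∉A)))) A≢B

∣∣<⇒∃ : {A B : Subset n} → ∣ A ∣ < ∣ B ∣ → ∃[ i ] i ∈ B × i ∉ A
∣∣<⇒∃ {A = A} {B} lt with Finₚ.any? (λ i → (i ∈? B) ×-dec ¬? (i ∈? A))
... | yes found = found
... | no ∄ = contradiction lt (ℕₚ.≤⇒≯ (p⊆q⇒∣p∣≤∣q∣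
  (λ {i} i∈B → decidable-stable (i ∈? A) (λ i∉A → ∄ (i , i∈B , i∉A)))))

-- Sums over a subset are written as sums over all of `Fin n` with zeros filled in, so that double
-- sums can be exchanged freely.
masked : (Fin n → ℕ) → Subset n → Fin n → ℕ
masked w A j = if does (j ∈? A) then w j else 0

weight : (Fin n → ℕ) → Subset n → ℕ
weight w A = sum (masked w A)

weight-1 : (A : Subset n) → weight (const 1) A ≡ ∣ A ∣
weight-1 []            = refl
weight-1 (inside  ∷ A) = cong suc (weight-1 A)
weight-1 (outside ∷ A) = weight-1 A

weight-⊥ : (w : Fin n → ℕ) → weight w ⊥ ≡ 0
weight-⊥ {zero}  w = refl
weight-⊥ {suc n} w = weight-⊥ (w ∘ suc)

weight-⊤ : (w : Fin n → ℕ) → weight w ⊤ ≡ sum w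
weight-⊤ {zero}  w = refl
weight-⊤ {suc n} w = cong (w zero +_) (weight-⊤ (w ∘ suc))

weight-⁅⁆ : (w : Fin n → ℕ) (j : Fin n) → weight w ⁅ j ⁆ ≡ w j
weight-⁅⁆ w zero    = trans (cong (w zero +_) (weight-⊥ (w ∘ suc))) (ℕₚ.+-identityʳ _)
weight-⁅⁆ w (suc j) = weight-⁅⁆ (w ∘ suc) j

weight-modular : (w : Fin n → ℕ) (A B : Subset n) →
  weight w (A ∪ B) + weight w (A ∩ B) ≡ weight w A + weight w B
weight-modular w A B = begin
  weight w (A ∪ B) + weight w (A ∩ B)                     ≡⟨ ∑-distrib-+ (masked w (A ∪ B)) (masked w (A ∩ B)) ⟨
  sum (λ j → masked w (A ∪ B) j + masked w (A ∩ B) j)     ≡⟨ sum-cong-≗ pointwise ⟩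
  sum (λ j → masked w A j + masked w B j)                 ≡⟨ ∑-distrib-+ (masked w A) (masked w B) ⟩
  weight w A + weight w B                                 ∎
  where
  open ≡-Reasoning
  pointwise : ∀ j → masked w (A ∪ B) j + masked w (A ∩ B) j ≡ masked w A j + masked w B j
  pointwise j rewrite does-∈? j (A ∪ B) | does-∈? j (A ∩ B) | does-∈? j A | does-∈? j B
    | Vecₚ.lookup-zipWith _∨_ j A B | Vecₚ.lookup-zipWith _∧_ j A B
    with Vec.lookup A j | Vec.lookup B j
  ... | true  | true  = refl
  ... | true  | false = refl
  ... | false | true  = ℕₚ.+-identityʳ _
  ... | false | false = refl

∣∪∣+∣∩∣ : (A B : Subset n) → ∣ A ∪ B ∣ + ∣ A ∩ B ∣ ≡ ∣ A ∣ + ∣ B ∣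
∣∪∣+∣∩∣ A B = subst₂ _≡_
  (cong₂ _+_ (weight-1 (A ∪ B)) (weight-1 (A ∩ B)))
  (cong₂ _+_ (weight-1 A) (weight-1 B))
  (weight-modular (const 1) A B)

weight-∁ : (w : Fin n → ℕ) (A : Subset n) → weight w A + weight w (∁ A) ≡ sum w
weight-∁ w A = begin
  weight w A + weight w (∁ A)             ≡⟨ weight-modular w A (∁ A) ⟨
  weight w (A ∪ ∁ A) + weight w (A ∩ ∁ A) ≡⟨ cong₂ (λ B C → weight w B + weight w C) (∪-inverseʳ A) (∩-inverseʳ A) ⟩
  weight w ⊤ + weight w ⊥                 ≡⟨ cong₂ _+_ (weight-⊤ w) (weight-⊥ w) ⟩
  sum w + 0                               ≡⟨ ℕₚ.+-identityʳ _ ⟩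
  sum w                                   ∎
  where open ≡-Reasoning

-- Neighbours, tight sets and restriction to one partner

neighbours : (Fin m → Subset n) → Subset n → Subset m
neighbours R A = ⟦ (λ i → nonempty? (R i ∩ A)) ⟧

module _ (R : Fin m → Subset n) where

  ∈-neighbours⁺ : ∀ {A i j} → j ∈ R i → j ∈ A → i ∈ neighbours R A
  ∈-neighbours⁺ {A} j∈Ri j∈A =
    ∈-⟦⟧⁺ (λ i → nonempty? (R i ∩ A)) (_ , x∈p∩q⁺ (j∈Ri , j∈A))

  ∈-neighbours⁻ : ∀ {A i} → i ∈ neighbours R A → ∃[ j ] j ∈ R i × j ∈ A
  ∈-neighbours⁻ {A} i∈
    with j , j∈ ← ∈-⟦⟧⁻ (λ i → nonempty? (R i ∩ A)) i∈ = j , x∈p∩q⁻ _ _ j∈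

restrict : (Fin m → Subset n) → Fin m → Fin n → Fin m → Subset n
restrict R i j = Vector.updateAt R i (const ⁅ j ⁆)

restrict-⊆ : ∀ (R : Fin m → Subset n) {i j} → j ∈ R i → ∀ i′ → restrict R i j i′ ⊆ R i′
restrict-⊆ R {i} {j} j∈R i′ {j′} j′∈ with i′ Fin.≟ i
... | no i′≢i = subst (j′ ∈_) (updateAt-minimal i′ i R i′≢i) j′∈
... | yes refl
  with refl ← x∈⁅y⁆⇒x≡y j (subst (j′ ∈_) (updateAt-updates i R) j′∈)
  = j∈R

module _ (w : Fin n → ℕ) where

  Hall : (Fin m → Subset n) → Set
  Hall R = ∀ A → weight w A ≤ ∣ neighbours R A ∣

  -- Under Hall's condition the opposite inequality always holds, so these are the sets with
  -- equality.
  Tight : (Fin m → Subset n) → Subset n → Set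
  Tight R A = ∣ neighbours R A ∣ ≤ weight w A

  module _ (R : Fin m → Subset n) (hall : Hall R) where

    -- The only sets that can violate Hall's condition once i is restricted to j.
    Obstructs : Fin m → Fin n → Subset n → Set
    Obstructs i j A = Tight R A × i ∈ neighbours R A × j ∉ A

    -- Restriction removes at most i from the neighbours of A, so a violation means that A had no
    -- neighbour to spare. If i were not a neighbour, or if j lay in A, nothing would be removed at
    -- all.
    restrict-obstruction : ∀ {i j A} →
      ∣ neighbours (restrict R i j) A ∣ < weight w A → Obstructs i j A
    restrict-obstruction {i} {j} {A} violated = tight , i∈N , j∉A
      where
      N N′ : Subset m
      N  = neighbours R A
      N′ = neighbours (restrict R i j) A

      others : ∀ {i′} → i′ ≢ i → i′ ∈ N → i′ ∈ N′
      others {i′} i′≢i i′∈N with j′ , j′∈R , j′∈A ← ∈-neighbours⁻ R i′∈N =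
        ∈-neighbours⁺ (restrict R i j)
          (subst (j′ ∈_) (sym (updateAt-minimal i′ i R i′≢i)) j′∈R) j′∈A

      N⊈N′ : ¬ N ⊆ N′
      N⊈N′ N⊆N′ = ℕₚ.<⇒≱ violated (ℕₚ.≤-trans (hall A) (p⊆q⇒∣p∣≤∣q∣ N⊆N′))

      i∈N : i ∈ N
      i∈N = decidable-stable (i ∈? N) λ i∉N →
        N⊈N′ λ i′∈N → others (λ { refl → i∉N i′∈N }) i′∈N

      j∉A : j ∉ A
      j∉A j∈A = N⊈N′ λ {i′} i′∈N → case i′ Fin.≟ i of λ where
        (no i′≢i) → others i′≢i i′∈N
        (yes refl) → ∈-neighbours⁺ (restrict R i j)
          (subst (j ∈_) (sym (updateAt-updates i R)) (x∈⁅x⁆ j)) j∈A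

      N⊆ : N ⊆ ⁅ i ⁆ ∪ N′
      N⊆ {i′} i′∈N with i′ Fin.≟ i
      ... | yes refl = x∈p∪q⁺ (inj₁ (x∈⁅x⁆ i))
      ... | no i′≢i  = x∈p∪q⁺ (inj₂ (others i′≢i i′∈N))

      tight : ∣ N ∣ ≤ weight w A
      tight = begin
        ∣ N ∣                               ≤⟨ p⊆q⇒∣p∣≤∣q∣ N⊆ ⟩
        ∣ ⁅ i ⁆ ∪ N′ ∣                      ≤⟨ ℕₚ.m≤m+n _ _ ⟩
        ∣ ⁅ i ⁆ ∪ N′ ∣ + ∣ ⁅ i ⁆ ∩ N′ ∣     ≡⟨ ∣∪∣+∣∩∣ ⁅ i ⁆ N′ ⟩
        ∣ ⁅ i ⁆ ∣ + ∣ N′ ∣                  ≡⟨ cong (_+ ∣ N′ ∣) (∣⁅x⁆∣≡1 i) ⟩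
        suc ∣ N′ ∣                          ≤⟨ violated ⟩
        weight w A                          ∎
        where open ℕₚ.≤-Reasoning

    restrict-hall : ∀ {i j} → (∀ A → ¬ Obstructs i j A) → Hall (restrict R i j)
    restrict-hall ∄ A = ℕₚ.≮⇒≥ (∄ A ∘ restrict-obstruction)

    private
      N = neighbours R

      N-∪ : ∀ A B → N (A ∪ B) ⊆ N A ∪ N B
      N-∪ A B i∈ with j , j∈R , j∈ ← ∈-neighbours⁻ R i∈ with x∈p∪q⁻ A B j∈
      ... | inj₁ j∈A = x∈p∪q⁺ (inj₁ (∈-neighbours⁺ R j∈R j∈A))
      ... | inj₂ j∈B = x∈p∪q⁺ (inj₂ (∈-neighbours⁺ R j∈R j∈B))

      N-∩ : ∀ A B → N (A ∩ B) ⊆ N A ∩ N B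
      N-∩ A B i∈ with j , j∈R , j∈ ← ∈-neighbours⁻ R i∈ with j∈A , j∈B ← x∈p∩q⁻ A B j∈ =
        x∈p∩q⁺ (∈-neighbours⁺ R j∈R j∈A , ∈-neighbours⁺ R j∈R j∈B)

    -- The size of the neighbourhood is submodular and the weight is modular, so Hall's bound for A
    -- ∪ B leaves only this much for the intersection. Bounding `N A ∩ N B`, which contains
    -- `N (A ∩ B)`, is what also yields `N-∩-tight`.
    tight-∩ : ∀ {A B} → Tight R A → Tight R B →
      ∣ N A ∩ N B ∣ ≤ weight w (A ∩ B)
    tight-∩ {A} {B} tA tB = ℕₚ.+-cancelˡ-≤ (weight w (A ∪ B)) _ _ (begin
      weight w (A ∪ B) + ∣ N A ∩ N B ∣     ≤⟨ ℕₚ.+-monoˡ-≤ _ (hall (A ∪ B)) ⟩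
      ∣ N (A ∪ B) ∣ + ∣ N A ∩ N B ∣        ≤⟨ ℕₚ.+-monoˡ-≤ _ (p⊆q⇒∣p∣≤∣q∣ (N-∪ A B)) ⟩
      ∣ N A ∪ N B ∣ + ∣ N A ∩ N B ∣        ≡⟨ ∣∪∣+∣∩∣ (N A) (N B) ⟩
      ∣ N A ∣ + ∣ N B ∣                    ≤⟨ ℕₚ.+-mono-≤ tA tB ⟩
      weight w A + weight w B              ≡⟨ weight-modular w A B ⟨
      weight w (A ∪ B) + weight w (A ∩ B)  ∎)
      where open ℕₚ.≤-Reasoning

    -- Hall's condition for A ∩ B and `tight-∩` leave no room for a proper inclusion. In `shrink`
    -- this keeps i among the neighbours of the smaller set.
    N-∩-tight : ∀ {A B} → Tight R A → Tight R B → N (A ∩ B) ≡ N A ∩ N B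
    N-∩-tight {A} {B} tA tB = decidable-stable (N (A ∩ B) ≟ˢ (N A ∩ N B)) λ ≢ →
      ℕₚ.<⇒≱ (p⊂q⇒∣p∣<∣q∣ (⊆∧≢⇒⊂ (N-∩ A B) ≢))
        (ℕₚ.≤-trans (tight-∩ tA tB) (hall (A ∩ B)))

    -- If restricting i to some j ∈ T is obstructed by A, then A ∩ T is a smaller
    -- choice of T: tight sets are closed under ∩, and N (A ∩ T) = N A ∩ N T for them.
    shrink : ∀ {i} T → Acc _⊂_ T → Tight R T → i ∈ N T →
      ∃[ j ] j ∈ R i × Hall (restrict R i j)
    shrink {i} T (acc rec) tT i∈NT
      with j , j∈R , j∈T ← ∈-neighbours⁻ R i∈NT
      with anySubset? (λ A → ∣ neighbours (restrict R i j) A ∣ ℕ.<? weight w A)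
    ... | no  ∄             = j , j∈R , λ A → ℕₚ.≮⇒≥ λ violated → ∄ (A , violated)
    ... | yes (A , violated)
      with tA , i∈NA , j∉A ← restrict-obstruction violated =
      shrink (A ∩ T)
        (rec (p∩q⊆q A T , j , j∈T , j∉A ∘ proj₁ ∘ x∈p∩q⁻ A T))
        (ℕₚ.≤-trans (p⊆q⇒∣p∣≤∣q∣ (N-∩ A T)) (tight-∩ tA tT))
        (subst (i ∈_) (sym (N-∩-tight tA tT)) (x∈p∩q⁺ (i∈NA , i∈NT)))

  module _ (total : sum w ≡ m) where

    -- As the weights add up to m, ⊤ is tight and Hall's condition makes every i its neighbour; so
    -- the descent of `shrink` can start at ⊤.
    restrictable : (R : Fin m → Subset n) → Hall R → ∀ i →
      ∃[ j ] j ∈ R i × Hall (restrict R i j)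
    restrictable R hall i =
      shrink R hall ⊤ (⊂-wellFounded ⊤)
        (subst (∣ neighbours R ⊤ ∣ ≤_) (sym w⊤) (∣p∣≤n (neighbours R ⊤)))
        (subst (i ∈_) (sym (∣p∣≡n⇒p≡⊤ (ℕₚ.≤-antisym (∣p∣≤n (neighbours R ⊤))
          (subst (_≤ ∣ neighbours R ⊤ ∣) w⊤ (hall ⊤))))) ∈⊤)
      where
      w⊤ : weight w ⊤ ≡ m
      w⊤ = trans (weight-⊤ w) total

    restrictAll : (R : Fin m → Subset n) → Hall R → ∀ is →
      ∃[ R′ ] Hall R′ × (∀ i → R′ i ⊆ R i) ×
              (∀ i → i ListMem.∈ is → ∃[ j ] R′ i ≡ ⁅ j ⁆)
    restrictAll R hall []       = R , hall , (λ i j∈ → j∈) , λ i ()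
    restrictAll R hall (i ∷ is)
      with R′ , hall′ , R′⊆R , single ← restrictAll R hall is
      with j , j∈R′ , hall″ ← restrictable R′ hall′ i
      = restrict R′ i j , hall″
      , (λ i′ → R′⊆R i′ ∘ restrict-⊆ R′ j∈R′ i′) , single′
      where
      single′ : ∀ i′ → i′ ListMem.∈ i ∷ is → ∃[ j′ ] restrict R′ i j i′ ≡ ⁅ j′ ⁆
      single′ i′ i′∈ with i′ Fin.≟ i
      ... | yes refl = j , updateAt-updates i R′
      ... | no i′≢i with i′∈
      ...   | here i′≡i = contradiction i′≡i i′≢i
      ...   | there i′∈is with j′ , eq ← single i′ i′∈is =
        j′ , trans (updateAt-minimal i′ i R′ i′≢i) eq

    hall-theorem : (R : Fin m → Subset n) → Hall R →
      ∃[ M ] (∀ i → M i ∈ R i) × (∀ j → ∣ preimage M ⁅ j ⁆ ∣ ≡ w j)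
    hall-theorem R hall
      with R′ , hall′ , R′⊆R , single ← restrictAll R hall (allFin m)
      = M , M∈R , λ j → ℕₚ.≤-antisym (upper j)
          (subst (_≤ ∣ preimage M ⁅ j ⁆ ∣) (weight-⁅⁆ w j) (lower ⁅ j ⁆))
      where
      M : Fin m → Fin n
      M i = proj₁ (single i (ListMemₚ.∈-allFin i))

      R′≡ : ∀ i → R′ i ≡ ⁅ M i ⁆
      R′≡ i = proj₂ (single i (ListMemₚ.∈-allFin i))

      M∈R : ∀ i → M i ∈ R i
      M∈R i = R′⊆R i (subst (M i ∈_) (sym (R′≡ i)) (x∈⁅x⁆ (M i)))

      lower : ∀ A → weight w A ≤ ∣ preimage M A ∣
      lower A = ℕₚ.≤-trans (hall′ A) (p⊆q⇒∣p∣≤∣q∣ N⊆)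
        where
        N⊆ : neighbours R′ A ⊆ preimage M A
        N⊆ {i} i∈ with j , j∈ , j∈A ← ∈-neighbours⁻ R′ i∈
          with refl ← x∈⁅y⁆⇒x≡y (M i) (subst (j ∈_) (R′≡ i) j∈)
          = ∈-⟦⟧⁺ (λ i → M i ∈? A) j∈A

      -- Too many husbands for j would leave too few for the others: `lower` applies to the
      -- complement of j, and there are only m = `sum w` boys to share.
      upper : ∀ j → ∣ preimage M ⁅ j ⁆ ∣ ≤ w j
      upper j = ℕₚ.+-cancelʳ-≤ (weight w (∁ ⁅ j ⁆)) _ _ (begin
        ∣ P ∣ + weight w (∁ ⁅ j ⁆)          ≤⟨ ℕₚ.+-monoʳ-≤ ∣ P ∣ (lower (∁ ⁅ j ⁆)) ⟩
        ∣ P ∣ + ∣ preimage M (∁ ⁅ j ⁆) ∣    ≤⟨ ℕₚ.+-monoʳ-≤ ∣ P ∣ (p⊆q⇒∣p∣≤∣q∣ P∁⊆) ⟩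
        ∣ P ∣ + ∣ ∁ P ∣                     ≡⟨ cong (∣ P ∣ +_) (∣∁p∣≡n∸∣p∣ P) ⟩
        ∣ P ∣ + (m ∸ ∣ P ∣)                 ≡⟨ ℕₚ.m+[n∸m]≡n (∣p∣≤n P) ⟩
        m                                   ≡⟨ total ⟨
        sum w                               ≡⟨ weight-∁ w ⁅ j ⁆ ⟨
        weight w ⁅ j ⁆ + weight w (∁ ⁅ j ⁆) ≡⟨ cong (_+ weight w (∁ ⁅ j ⁆)) (weight-⁅⁆ w j) ⟩
        w j + weight w (∁ ⁅ j ⁆)            ∎)
        where
        open ℕₚ.≤-Reasoning
        P : Subset m
        P = preimage M ⁅ j ⁆
        P∁⊆ : preimage M (∁ ⁅ j ⁆) ⊆ ∁ P
        P∁⊆ i∈ = x∉p⇒x∈∁p λ i∈P →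
          x∈∁p⇒x∉p (∈-⟦⟧⁻ (λ i → M i ∈? ∁ ⁅ j ⁆) i∈) (∈-⟦⟧⁻ (λ i → M i ∈? ⁅ j ⁆) i∈P)

sum-const : ∀ n c → sum {n} (λ _ → c) ≡ n * c
sum-const zero    c = refl
sum-const (suc n) c = cong (c +_) (sum-const n c)

sum-⁅⁆ : (w : Fin n → ℕ) (i : Fin n) →
  ∑[ j < n ] (if does (i ∈? ⁅ j ⁆) then w j else 0) ≡ w i
sum-⁅⁆ {n} w i = trans (sum-cong-≗ flipped) (weight-⁅⁆ w i)
  where
  flipped : ∀ j → (if does (i ∈? ⁅ j ⁆) then w j else 0) ≡ masked w ⁅ i ⁆ j
  flipped j with i Fin.≟ j
  ... | yes refl = refl
  ... | no  i≢j
    rewrite dec-false (i ∈? ⁅ j ⁆) (x≢y⇒x∉⁅y⁆ i≢j)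
          | dec-false (j ∈? ⁅ i ⁆) (x≢y⇒x∉⁅y⁆ (i≢j ∘ sym)) = refl

sum-indicator-⁅⁆ : (i : Fin n) → ∑[ j < n ] (if does (i ∈? ⁅ j ⁆) then 1 else 0) ≡ 1
sum-indicator-⁅⁆ = sum-⁅⁆ (const 1)

∣preimage∣ : (M : Fin m → Fin n) (w : Fin n → ℕ) →
  (∀ j → ∣ preimage M ⁅ j ⁆ ∣ ≡ w j) → ∀ A → ∣ preimage M A ∣ ≡ weight w A
∣preimage∣ {m} {n} M w fibres A = begin
  ∣ preimage M A ∣
    ≡⟨ ∣⟦⟧∣ (λ i → M i ∈? A) ⟩
  ∑[ i < m ] (if does (M i ∈? A) then 1 else 0)
    ≡⟨ sum-cong-≗ (λ i → sum-⁅⁆ (masked (const 1) A) (M i)) ⟨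
  ∑[ i < m ] ∑[ j < n ] (if does (M i ∈? ⁅ j ⁆) then masked (const 1) A j else 0)
    ≡⟨ ∑-comm (λ i j → if does (M i ∈? ⁅ j ⁆) then masked (const 1) A j else 0) ⟩
  ∑[ j < n ] ∑[ i < m ] (if does (M i ∈? ⁅ j ⁆) then masked (const 1) A j else 0)
    ≡⟨ sum-cong-≗ fibre ⟩
  weight w A ∎
  where
  open ≡-Reasoning
  fibre : ∀ j → ∑[ i < m ] (if does (M i ∈? ⁅ j ⁆) then masked (const 1) A j else 0)
                ≡ masked w A j
  fibre j with does (j ∈? A)
  ... | true  = trans (sym (∣⟦⟧∣ (λ i → M i ∈? ⁅ j ⁆))) (fibres j)
  ... | false = trans (sum-cong-≗ zeros) (sum-replicate-zero m)
    where
    zeros : ∀ i → (if does (M i ∈? ⁅ j ⁆) then 0 else 0) ≡ 0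
    zeros i with does (M i ∈? ⁅ j ⁆)
    ... | true  = refl
    ... | false = refl

-- Arrangements and the strict form of Hall's condition

module _ (w : Fin n → ℕ) (R : Fin m → Subset n) where

  Arranges : (Fin m → Fin n) → Set
  Arranges M = (∀ i → M i ∈ R i) × (∀ j → ∣ preimage M ⁅ j ⁆ ∣ ≡ w j)

  StrictHall : Set
  StrictHall = ∀ A → A ≢ ⊥ → A ≢ ⊤ → weight w A < ∣ neighbours R A ∣

  preimage⊆neighbours : ∀ {M} → Arranges M → ∀ A → preimage M A ⊆ neighbours R A
  preimage⊆neighbours {M} (M∈R , _) A i∈ =
    ∈-neighbours⁺ R (M∈R _) (∈-⟦⟧⁻ (λ i → M i ∈? A) i∈)

  two-arrangements⇒strict : ∀ {M₁ M₂} → Arranges M₁ → Arranges M₂ → ∀ A →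
    preimage M₁ A ≢ preimage M₂ A → weight w A < ∣ neighbours R A ∣
  two-arrangements⇒strict {M₁} {M₂} ar₁ ar₂ A ≢
    with preimage M₁ A ≟ˢ neighbours R A | preimage M₂ A ≟ˢ neighbours R A
  ... | yes eq₁ | yes eq₂ = contradiction (trans eq₁ (sym eq₂)) ≢
  ... | no  ≢₁  | _       = subst (_< ∣ neighbours R A ∣) (∣preimage∣ M₁ w (proj₂ ar₁) A)
    (p⊂q⇒∣p∣<∣q∣ (⊆∧≢⇒⊂ (preimage⊆neighbours ar₁ A) ≢₁))
  ... | yes _   | no  ≢₂  = subst (_< ∣ neighbours R A ∣) (∣preimage∣ M₂ w (proj₂ ar₂) A)
    (p⊂q⇒∣p∣<∣q∣ (⊆∧≢⇒⊂ (preimage⊆neighbours ar₂ A) ≢₂))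

  module _ (total : sum w ≡ m) (inhabited : ∀ i → Nonempty (R i)) (strict : StrictHall) where

    -- Only the two sets exempt from strictness need an argument: ⊥ has weight 0, and ⊤ has weight m
    -- while every i is its neighbour.
    strict⇒hall : Hall w R
    strict⇒hall A with A ≟ˢ ⊥ | A ≟ˢ ⊤
    ... | yes refl | _        = subst (_≤ _) (sym (weight-⊥ w)) z≤n
    ... | no _     | yes refl = ℕₚ.≤-reflexive (begin
      weight w ⊤             ≡⟨ weight-⊤ w ⟩
      sum w                  ≡⟨ total ⟩
      m                      ≡⟨ ∣⊤∣≡n m ⟨
      ∣ ⊤ {n = m} ∣                  ≡⟨ cong ∣_∣ (⊆-antisym (λ {i} _ → everyone i) (⊆-max (neighbours R ⊤))) ⟩
      ∣ neighbours R ⊤ ∣     ∎)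
      where
      open ≡-Reasoning
      everyone : ∀ i → i ∈ neighbours R ⊤
      everyone i with j , j∈R ← inhabited i = ∈-neighbours⁺ R j∈R ∈⊤
    ... | no A≢⊥   | no A≢⊤   = ℕₚ.<⇒≤ (strict A A≢⊥ A≢⊤)

    -- An obstructing set has i as a neighbour, so it is not ⊥, and it misses j, so it is not ⊤;
    -- strictness then contradicts its tightness.
    edge-hall : ∀ {i j} → Hall w (restrict R i j)
    edge-hall {i} {j} = restrict-hall w R strict⇒hall λ A (tight , i∈N , j∉A) →
      ℕₚ.<⇒≱ (strict A
        (λ { refl → let _ , _ , ∈⊥ = ∈-neighbours⁻ R i∈N in ∉⊥ ∈⊥ })
        (λ { refl → j∉A ∈⊤ })) tight

    edge-arrangement : ∀ {i j} → j ∈ R i → ∃[ M ] Arranges M × M i ≡ j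
    edge-arrangement {i} {j} j∈R =
      let M , M∈R′ , fibres = hall-theorem w total (restrict R i j) edge-hall in
      M , ((λ i′ → restrict-⊆ R j∈R i′ (M∈R′ i′)) , fibres)
      , x∈⁅y⁆⇒x≡y j (subst (M i ∈_) (updateAt-updates i R) (M∈R′ i))

    strict⇒two-arrangements : Fin m → ∀ A → A ≢ ⊥ → A ≢ ⊤ →
      ∃₂ λ M₁ M₂ → Arranges M₁ × Arranges M₂ × preimage M₁ A ≢ preimage M₂ A
    strict⇒two-arrangements i₀ A A≢⊥ A≢⊤ =
      -- Any arrangement serves as `M₁`; `i₀` supplies a pair from which to build one.
      let M₁ , ar₁ , _     = edge-arrangement (proj₂ (inhabited i₀))
          i , i∈N , i∉M₁   = ∣∣<⇒∃ (subst (_< ∣ neighbours R A ∣)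
                               (sym (∣preimage∣ M₁ w (proj₂ ar₁) A)) (strict A A≢⊥ A≢⊤))
          j , j∈R , j∈A    = ∈-neighbours⁻ R i∈N
          M₂ , ar₂ , M₂i≡j = edge-arrangement j∈R
      in M₁ , M₂ , ar₁ , ar₂ , λ eq →
        i∉M₁ (subst (i ∈_) (sym eq)
          (∈-⟦⟧⁺ (λ i → M₂ i ∈? A) (subst (_∈ A) (sym M₂i≡j) j∈A)))

-- Sums of rationals

module _ {a b p} {A : Set a} {B : Set b} (_∙_ : B → B → B) (ε : B)
  (identityˡ : ∀ b → ε ∙ b ≡ b) {P : Pred A p} (P? : Decidable P) (g : A → B) where

  -- This links the list sums over `elements` in the definitions to the zero-padded sums used here,
  -- for ℕ and ℚ alike.
  foldr-filter-tabulate : (f : Fin n → A) →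
    List.foldr _∙_ ε (List.map g (List.filter P? (List.tabulate f))) ≡
    Vector.foldr _∙_ ε (λ i → if does (P? (f i)) then g (f i) else ε)
  foldr-filter-tabulate {zero}  f = refl
  foldr-filter-tabulate {suc n} f with does (P? (f zero))
  ... | true  = cong (g (f zero) ∙_) (foldr-filter-tabulate (f ∘ suc))
  ... | false = trans (foldr-filter-tabulate (f ∘ suc)) (sym (identityˡ _))

sum-elements : (w : Fin n → ℕ) (A : Subset n) →
  sumᴸ (List.map w (elements A)) ≡ weight w A
sum-elements w A = foldr-filter-tabulate _+_ 0 (λ _ → refl) (_∈? A) w (λ i → i)

ι : ℕ → ℚ
ι n = ℤ.+ n ℚ./ 1

private
  -- For a variable n the fraction `ι n` is stuck on a gcd; the explicit normal form lets the
  -- rational operations compute.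
  ι≡ : ∀ n → ι n ≡ mkℚ (ℤ.+ n) 0 (coprime-sym (1-coprimeTo n))
  ι≡ n = ℚₚ.normalize-coprime (coprime-sym (1-coprimeTo n))

ι-+ : ∀ a b → ι (a + b) ≡ ι a ℚ.+ ι b
ι-+ a b = sym (begin
  ι a ℚ.+ ι b ≡⟨ cong₂ ℚ._+_ (ι≡ a) (ι≡ b) ⟩
  (ℤ.+ a ℤ.* ℤ.+ 1 ℤ.+ ℤ.+ b ℤ.* ℤ.+ 1) ℚ./ 1
    ≡⟨ cong (ℚ._/ 1) (cong₂ ℤ._+_ (ℤₚ.*-identityʳ (ℤ.+ a)) (ℤₚ.*-identityʳ (ℤ.+ b))) ⟩
  ι (a + b) ∎)
  where open ≡-Reasoning

ι-nonneg : ∀ n → 0ℚ ℚ.≤ ι n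
ι-nonneg n = ℚₚ.nonNegative⁻¹ (ι n) {{ℚₚ.normalize-nonNeg n 1}}

ι-mono-≤ : ∀ {a b} → a ≤ b → ι a ℚ.≤ ι b
ι-mono-≤ {a} a≤b with c , refl ← ℕₚ.m≤n⇒∃[o]m+o≡n a≤b = begin
  ι a           ≡⟨ ℚₚ.+-identityʳ (ι a) ⟨
  ι a ℚ.+ 0ℚ    ≤⟨ ℚₚ.+-monoʳ-≤ (ι a) (ι-nonneg c) ⟩
  ι a ℚ.+ ι c   ≡⟨ ι-+ a c ⟨
  ι (a + c)     ∎
  where open ℚₚ.≤-Reasoning

ι-cancel-< : ∀ {a b} → ι a ℚ.< ι b → a < b
ι-cancel-< lt = ℕₚ.≰⇒> λ b≤a →
  ℚₚ.<-irrefl refl (ℚₚ.<-≤-trans lt (ι-mono-≤ b≤a))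

ι-sum : (f : Fin n → ℕ) → ι (sum f) ≡ ℚΣ.sum (ι ∘ f)
ι-sum {zero}  f = refl
ι-sum {suc n} f = trans (ι-+ (f zero) _) (cong (ι (f zero) ℚ.+_) (ι-sum (f ∘ suc)))

recip : ∀ n .{{_ : NonZero n}} → ∃[ c ] 0ℚ ℚ.< c × ι n ℚ.* c ≡ 1ℚ
recip (suc n) = 1/ι , ℚₚ.positive⁻¹ 1/ι {{ℚₚ.1/pos⇒pos (ι (suc n))}} , ℚₚ.*-inverseʳ (ι (suc n))
  where
  instance
    pos : ℚ.Positive (ι (suc n))
    pos = ℚₚ.normalize-pos (suc n) 1
    nonzero : ℚ.NonZero (ι (suc n))
    nonzero = ℚₚ.pos⇒nonZero (ι (suc n))
  1/ι : ℚ
  1/ι = ℚ.1/ ι (suc n)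

ℚsum-const : ∀ n c → ℚΣ.sum {n} (λ _ → c) ≡ ι n ℚ.* c
ℚsum-const zero    c = sym (ℚₚ.*-zeroˡ c)
ℚsum-const (suc n) c = begin
  c ℚ.+ ℚΣ.sum {n} (λ _ → c)   ≡⟨ cong₂ ℚ._+_ (sym (ℚₚ.*-identityˡ c)) (ℚsum-const n c) ⟩
  1ℚ ℚ.* c ℚ.+ ι n ℚ.* c       ≡⟨ ℚₚ.*-distribʳ-+ c 1ℚ (ι n) ⟨
  (1ℚ ℚ.+ ι n) ℚ.* c           ≡⟨ cong (ℚ._* c) (ι-+ 1 n) ⟨
  ι (suc n) ℚ.* c              ∎
  where open ≡-Reasoning

ι-* : ∀ a b → ι (a * b) ≡ ι a ℚ.* ι b
ι-* a b = begin
  ι (a * b)                  ≡⟨ cong ι (sum-const a b) ⟨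
  ι (sum {a} (λ _ → b))      ≡⟨ ι-sum {a} (λ _ → b) ⟩
  ℚΣ.sum {a} (λ _ → ι b)     ≡⟨ ℚsum-const a (ι b) ⟩
  ι a ℚ.* ι b                ∎
  where open ≡-Reasoning

ℚsum-mono : {f g : Fin n → ℚ} → (∀ i → f i ℚ.≤ g i) → ℚΣ.sum f ℚ.≤ ℚΣ.sum g
ℚsum-mono {zero}  f≤g = ℚₚ.≤-refl
ℚsum-mono {suc n} f≤g = ℚₚ.+-mono-≤ (f≤g zero) (ℚsum-mono (f≤g ∘ suc))

ℚsum-δ : (i : Fin n) (c : ℚ) → ℚΣ.sum (λ j → if does (i Fin.≟ j) then c else 0ℚ) ≡ c
ℚsum-δ {suc n} zero    c = trans (cong (c ℚ.+_) (ℚΣ.sum-replicate-zero n)) (ℚₚ.+-identityʳ c)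
ℚsum-δ {suc n} (suc i) c = trans (ℚₚ.+-identityˡ _) (ℚsum-δ i c)

archimedean : ∀ M {ε} → 0ℚ ℚ.< ε → ∃[ δ ] 0ℚ ℚ.< δ × ι M ℚ.* δ ℚ.< ε
archimedean M {ε} 0<ε =
  let c , 0<c , ιc≡1 = recip (suc M)
      instance
        ε-pos : ℚ.Positive ε
        ε-pos = ℚ.positive 0<ε
        c-pos : ℚ.Positive c
        c-pos = ℚ.positive 0<c
      -- Here δ is ε divided by M + 1 and not by M: this makes the inequality strict and admits M =
      -- 0.
      δ   = c ℚ.* ε
      0<δ = ℚₚ.positive⁻¹ δ {{ℚₚ.pos*pos⇒pos c ε}}
      open ℚₚ.≤-Reasoning
  in δ , 0<δ , (begin-strict
    ι M ℚ.* δ                ≡⟨ ℚₚ.+-identityˡ (ι M ℚ.* δ) ⟨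
    0ℚ ℚ.+ ι M ℚ.* δ         <⟨ ℚₚ.+-monoˡ-< (ι M ℚ.* δ) 0<δ ⟩
    δ ℚ.+ ι M ℚ.* δ          ≡⟨ cong (ℚ._+ ι M ℚ.* δ) (ℚₚ.*-identityˡ δ) ⟨
    1ℚ ℚ.* δ ℚ.+ ι M ℚ.* δ   ≡⟨ ℚₚ.*-distribʳ-+ δ 1ℚ (ι M) ⟨
    (1ℚ ℚ.+ ι M) ℚ.* δ       ≡⟨ cong (ℚ._* δ) (ι-+ 1 M) ⟨
    ι (suc M) ℚ.* δ          ≡⟨ ℚₚ.*-assoc (ι (suc M)) c ε ⟨
    ι (suc M) ℚ.* c ℚ.* ε    ≡⟨ cong (ℚ._* ε) ιc≡1 ⟩
    1ℚ ℚ.* ε                 ≡⟨ ℚₚ.*-identityˡ ε ⟩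
    ε                        ∎)

sumℝ-approx : ∀ {a} {A : Set a} (x : A → ℝ) (l : List A) t →
  approx (sumℝ (List.map x l)) t ≡
  List.foldr ℚ._+_ 0ℚ (List.map (λ i → approx (x i) t) l)
sumℝ-approx x []      t = refl
sumℝ-approx x (i ∷ l) t = cong (approx (x i) t ℚ.+_) (sumℝ-approx x l t)

sumℝ-elements : (x : Fin n → ℝ) (A : Subset n) (t : ℕ) →
  approx (sumℝ (List.map x (elements A))) t ≡
  ℚΣ.sum (λ i → if does (i ∈? A) then approx (x i) t else 0ℚ)
sumℝ-elements x A t = trans (sumℝ-approx x (elements A) t)
  (foldr-filter-tabulate ℚ._+_ 0ℚ ℚₚ.+-identityˡ (_∈? A) (λ i → approx (x i) t) (λ i → i))

sumℝ-scaled : (f : Fin n → ℕ) (c : ℚ) (A : Subset n) (t : ℕ) →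
  approx (sumℝ (List.map (λ i → fromℚ (ι (f i) ℚ.* c)) (elements A))) t ≡
  ι (weight f A) ℚ.* c
sumℝ-scaled f c A t =
  trans (go (elements A)) (cong (λ s → ι s ℚ.* c) (sum-elements f A))
  where
  open ≡-Reasoning
  go : ∀ l → approx (sumℝ (List.map (λ i → fromℚ (ι (f i) ℚ.* c)) l)) t ≡
             ι (sumᴸ (List.map f l)) ℚ.* c
  go []      = sym (ℚₚ.*-zeroˡ c)
  go (i ∷ l) = begin
    ι (f i) ℚ.* c ℚ.+ approx (sumℝ (List.map (λ i → fromℚ (ι (f i) ℚ.* c)) l)) t
      ≡⟨ cong (ι (f i) ℚ.* c ℚ.+_) (go l) ⟩
    ι (f i) ℚ.* c ℚ.+ ι (sumᴸ (List.map f l)) ℚ.* c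
      ≡⟨ ℚₚ.*-distribʳ-+ c (ι (f i)) (ι (sumᴸ (List.map f l))) ⟨
    (ι (f i) ℚ.+ ι (sumᴸ (List.map f l))) ℚ.* c
      ≡⟨ cong (ℚ._* c) (ι-+ (f i) (sumᴸ (List.map f l))) ⟨
    ι (f i + sumᴸ (List.map f l)) ℚ.* c ∎

pointwise⇒≈ : ∀ x y → (∀ t → approx x t ≡ approx y t) → x ≈ y
pointwise⇒≈ x y eq ε 0<ε = 0 , λ t _ →
  subst (λ d → ℚ.∣ d ∣ ℚ.< ε)
    (sym (trans (cong (ℚ._- approx y t) (eq t)) (ℚₚ.+-inverseʳ (approx y t)))) 0<ε

weight-supported : (f : Fin n → ℕ) (A : Subset n) → (∀ j → j ∉ A → f j ≡ 0) →
  weight f A ≡ sum f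
weight-supported f A vanishes = sum-cong-≗ pointwise
  where
  pointwise : ∀ j → masked f A j ≡ f j
  pointwise j with j ∈? A
  ... | yes j∈A = refl
  ... | no  j∉A = sym (vanishes j j∉A)

term≤sum : (f : Fin n → ℕ) (i : Fin n) → f i ≤ sum f
term≤sum f zero    = ℕₚ.m≤m+n _ _
term≤sum f (suc i) = ℕₚ.≤-trans (term≤sum (f ∘ suc) i) (ℕₚ.m≤n+m _ _)

-- Counting marriages over a family of arrangements

module _ (w : Fin n → ℕ) (R : Fin m → Subset n)
  (M : Fin k → Fin m → Fin n) (arranges : ∀ a → Arranges w R (M a)) where

  private
    married : Fin k → Fin m → Fin n → ℕ
    married a i j = if does (M a i ∈? ⁅ j ⁆) then 1 else 0

  -- This is k times the average of the arrangements: the counts stay natural numbers until the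
  -- solution divides them by k.
  marriages : Fin m → Fin n → ℕ
  marriages i j = ∑[ a < k ] married a i j

  marriages-row : ∀ i → sum (marriages i) ≡ k
  marriages-row i = begin
    ∑[ j < n ] ∑[ a < k ] married a i j ≡⟨ ∑-comm (λ j a → married a i j) ⟩
    ∑[ a < k ] ∑[ j < n ] married a i j ≡⟨ sum-cong-≗ (λ a → sum-indicator-⁅⁆ (M a i)) ⟩
    ∑[ a < k ] 1                        ≡⟨ sum-const k 1 ⟩
    k * 1                               ≡⟨ ℕₚ.*-identityʳ k ⟩
    k                                   ∎
    where open ≡-Reasoning

  marriages-column : ∀ j → ∑[ i < m ] marriages i j ≡ k * w j
  marriages-column j = begin
    ∑[ i < m ] ∑[ a < k ] married a i j ≡⟨ ∑-comm (λ i a → married a i j) ⟩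
    ∑[ a < k ] ∑[ i < m ] married a i j
      ≡⟨ sum-cong-≗ (λ a → trans (sym (∣⟦⟧∣ (λ i → M a i ∈? ⁅ j ⁆))) (proj₂ (arranges a) j)) ⟩
    ∑[ a < k ] w j                      ≡⟨ sum-const k (w j) ⟩
    k * w j                             ∎
    where open ≡-Reasoning

  marriages-vanish : ∀ {i j} → j ∉ R i → marriages i j ≡ 0
  marriages-vanish {i} {j} j∉R = trans (sum-cong-≗ zeros) (sum-replicate-zero k)
    where
    zeros : ∀ a → married a i j ≡ 0
    zeros a rewrite dec-false (M a i ∈? ⁅ j ⁆) (λ M∈ →
      j∉R (subst (_∈ R i) (x∈⁅y⁆⇒x≡y j M∈) (proj₁ (arranges a) i))) = refl

  marriages-pos : ∀ {a i j} → M a i ≡ j → 1 ≤ marriages i j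
  marriages-pos {a} {i} {j} refl =
    subst (_≤ marriages i j) (cong (if_then 1 else 0) (dec-true (M a i ∈? ⁅ j ⁆) (x∈⁅x⁆ j)))
      (term≤sum (λ a → married a i j) a)

-- Approximate solutions of the linear system

module _ (w : Fin n → ℕ) (R : Fin m → Subset n) (z : Fin m → Fin n → ℚ) {δ ε : ℚ}
  (0≤δ      : 0ℚ ℚ.≤ δ)
  (mδ+nδ<ε  : ι (m + n) ℚ.* δ ℚ.< ε)
  (nonneg   : ∀ i j → 0ℚ ℚ.≤ z i j)
  (vanishes : ∀ i j → j ∉ R i → z i j ≡ 0ℚ)
  (row≤     : ∀ i → ℚΣ.sum (z i) ℚ.≤ 1ℚ ℚ.+ δ)
  (≤column  : ∀ j → ι (w j) ℚ.≤ ℚΣ.sum (λ i → z i j) ℚ.+ δ)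
  {i₀ j₀} (ε≤z : ε ℚ.≤ z i₀ j₀) {A} (i₀∈N : i₀ ∈ neighbours R A) (j₀∉A : j₀ ∉ A)
  where

  private
    -- E records the mass that row i₀ certainly loses outside A.
    zᴬ E : Fin m → Fin n → ℚ
    zᴬ i j = if does (j ∈? A) then z i j else 0ℚ
    E i j = if does (i₀ Fin.≟ i) then (if does (j₀ Fin.≟ j) then ε else 0ℚ) else 0ℚ

    ∑∑E : ℚΣ.sum (λ i → ℚΣ.sum (E i)) ≡ ε
    ∑∑E = trans (ℚΣ.sum-cong-≗ inner) (ℚsum-δ i₀ ε)
      where
      inner : ∀ i → ℚΣ.sum (E i) ≡ (if does (i₀ Fin.≟ i) then ε else 0ℚ)
      inner i with does (i₀ Fin.≟ i)
      ... | true  = ℚsum-δ j₀ ε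
      ... | false = ℚΣ.sum-replicate-zero n

    reached : Fin m → ℚ
    reached i = ι (masked (const 1) (neighbours R A) i)

    zᴬ≤z : ∀ i j → zᴬ i j ℚ.≤ z i j
    zᴬ≤z i j with does (j ∈? A)
    ... | true  = ℚₚ.≤-refl
    ... | false = nonneg i j

    -- At (i₀, j₀) the mask has removed the entry because j₀ ∉ A, which makes room for ε; everywhere
    -- else `E` is 0.
    zᴬ+E≤z : ∀ i j → zᴬ i j ℚ.+ E i j ℚ.≤ z i j
    zᴬ+E≤z i j with i₀ Fin.≟ i | j₀ Fin.≟ j
    ... | yes refl | yes refl rewrite dec-false (j₀ ∈? A) j₀∉A =
      subst (ℚ._≤ z i₀ j₀) (sym (ℚₚ.+-identityˡ ε)) ε≤z
    ... | yes _ | no _ = subst (ℚ._≤ z i j) (sym (ℚₚ.+-identityʳ (zᴬ i j))) (zᴬ≤z i j)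
    ... | no _  | _    = subst (ℚ._≤ z i j) (sym (ℚₚ.+-identityʳ (zᴬ i j))) (zᴬ≤z i j)

    -- A row outside the neighbourhood of A has only zeros in A, and `E` vanishes there because i₀
    -- is a neighbour. Hence just the neighbours contribute 1.
    row-bound : ∀ i → ℚΣ.sum (λ j → zᴬ i j ℚ.+ E i j) ℚ.≤ reached i ℚ.+ δ
    row-bound i with i ∈? neighbours R A
    ... | yes i∈N = ℚₚ.≤-trans (ℚsum-mono (zᴬ+E≤z i)) (row≤ i)
    ... | no  i∉N = begin
      ℚΣ.sum (λ j → zᴬ i j ℚ.+ E i j) ≡⟨ ℚΣ.sum-cong-≗ zeros ⟩
      ℚΣ.sum {n} (λ _ → 0ℚ)           ≡⟨ ℚΣ.sum-replicate-zero n ⟩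
      0ℚ                              ≤⟨ 0≤δ ⟩
      δ                               ≡⟨ ℚₚ.+-identityˡ δ ⟨
      0ℚ ℚ.+ δ                        ∎
      where
      open ℚₚ.≤-Reasoning
      zeros : ∀ j → zᴬ i j ℚ.+ E i j ≡ 0ℚ
      zeros j with i₀ Fin.≟ i | j ∈? A
      ... | yes refl | _       = contradiction i₀∈N i∉N
      ... | no _     | yes j∈A = trans (ℚₚ.+-identityʳ (z i j))
        (vanishes i j λ j∈R → i∉N (∈-neighbours⁺ R j∈R j∈A))
      ... | no _     | no _    = refl

    column-bound : ∀ j → ι (masked w A j) ℚ.≤ ℚΣ.sum (λ i → zᴬ i j) ℚ.+ δ
    column-bound j with does (j ∈? A)
    ... | true  = ≤column j
    ... | false = subst (0ℚ ℚ.≤_)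
      (sym (trans (cong (ℚ._+ δ) (ℚΣ.sum-replicate-zero m)) (ℚₚ.+-identityˡ δ))) 0≤δ

    ∑+δ : ∀ {p} (f : Fin p → ℚ) →
      ℚΣ.sum (λ i → f i ℚ.+ δ) ≡ ℚΣ.sum f ℚ.+ ι p ℚ.* δ
    ∑+δ {p} f = trans (ℚΣ.∑-distrib-+ f (λ _ → δ)) (cong (ℚΣ.sum f ℚ.+_) (ℚsum-const p δ))

    ∑∑zᴬ : ℚ
    ∑∑zᴬ = ℚΣ.sum (λ i → ℚΣ.sum (zᴬ i))

    column-total : ι (weight w A) ℚ.≤ ∑∑zᴬ ℚ.+ ι n ℚ.* δ
    column-total = begin
      ι (weight w A)                            ≡⟨ ι-sum (masked w A) ⟩
      ℚΣ.sum (λ j → ι (masked w A j))           ≤⟨ ℚsum-mono column-bound ⟩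
      ℚΣ.sum (λ j → ℚΣ.sum (λ i → zᴬ i j) ℚ.+ δ) ≡⟨ ∑+δ (λ j → ℚΣ.sum (λ i → zᴬ i j)) ⟩
      ℚΣ.sum (λ j → ℚΣ.sum (λ i → zᴬ i j)) ℚ.+ ι n ℚ.* δ
        ≡⟨ cong (ℚ._+ ι n ℚ.* δ) (ℚΣ.∑-comm (λ j i → zᴬ i j)) ⟩
      ∑∑zᴬ ℚ.+ ι n ℚ.* δ                        ∎
      where open ℚₚ.≤-Reasoning

    row-total : ∑∑zᴬ ℚ.+ ε ℚ.≤ ι ∣ neighbours R A ∣ ℚ.+ ι m ℚ.* δ
    row-total = begin
      ∑∑zᴬ ℚ.+ ε ≡⟨ cong (∑∑zᴬ ℚ.+_) ∑∑E ⟨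
      ∑∑zᴬ ℚ.+ ℚΣ.sum (λ i → ℚΣ.sum (E i))
        ≡⟨ ℚΣ.∑-distrib-+ (λ i → ℚΣ.sum (zᴬ i)) (λ i → ℚΣ.sum (E i)) ⟨
      ℚΣ.sum (λ i → ℚΣ.sum (zᴬ i) ℚ.+ ℚΣ.sum (E i))
        ≡⟨ ℚΣ.sum-cong-≗ (λ i → ℚΣ.∑-distrib-+ (zᴬ i) (E i)) ⟨
      ℚΣ.sum (λ i → ℚΣ.sum (λ j → zᴬ i j ℚ.+ E i j)) ≤⟨ ℚsum-mono row-bound ⟩
      ℚΣ.sum (λ i → reached i ℚ.+ δ) ≡⟨ ∑+δ reached ⟩
      ℚΣ.sum reached ℚ.+ ι m ℚ.* δ
        ≡⟨ cong (ℚ._+ ι m ℚ.* δ) (ι-sum (masked (const 1) (neighbours R A))) ⟨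
      ι (weight (const 1) (neighbours R A)) ℚ.+ ι m ℚ.* δ
        ≡⟨ cong (λ c → ι c ℚ.+ ι m ℚ.* δ) (weight-1 (neighbours R A)) ⟩
      ι ∣ neighbours R A ∣ ℚ.+ ι m ℚ.* δ ∎
      where open ℚₚ.≤-Reasoning

  -- The two totals spend one δ on each of the n columns and m rows. If the neighbours were not more
  -- than the weight, they would combine to ε ≤ (m + n) δ.
  approximate-solution⇒strict : weight w A < ∣ neighbours R A ∣
  approximate-solution⇒strict = ι-cancel-< (ℚₚ.≰⇒> λ N≤W →
    ℚₚ.<-irrefl refl (begin-strict
      ∑∑zᴬ ℚ.+ ε                                  ≤⟨ row-total ⟩
      ι ∣ neighbours R A ∣ ℚ.+ ι m ℚ.* δ          ≤⟨ ℚₚ.+-monoˡ-≤ (ι m ℚ.* δ) (ℚₚ.≤-trans N≤W column-total) ⟩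
      ∑∑zᴬ ℚ.+ ι n ℚ.* δ ℚ.+ ι m ℚ.* δ            ≡⟨ ℚₚ.+-assoc ∑∑zᴬ (ι n ℚ.* δ) (ι m ℚ.* δ) ⟩
      ∑∑zᴬ ℚ.+ (ι n ℚ.* δ ℚ.+ ι m ℚ.* δ)          ≡⟨ cong (∑∑zᴬ ℚ.+_) (ℚₚ.*-distribʳ-+ δ (ι n) (ι m)) ⟨
      ∑∑zᴬ ℚ.+ (ι n ℚ.+ ι m) ℚ.* δ                ≡⟨ cong (λ c → ∑∑zᴬ ℚ.+ c ℚ.* δ) (trans (ℚₚ.+-comm (ι n) (ι m)) (sym (ι-+ m n))) ⟩
      ∑∑zᴬ ℚ.+ ι (m + n) ℚ.* δ                    <⟨ ℚₚ.+-monoʳ-< ∑∑zᴬ mδ+nδ<ε ⟩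
      ∑∑zᴬ ℚ.+ ε                                  ∎))
    where open ℚₚ.≤-Reasoning

-- The proposition

Σ[2+]≡sum : ∀ N (f : ℕ → ℕ) → Σ[2+ N ] f ≡ ∑[ i < N ] f (2 + toℕ i)
Σ[2+]≡sum N f = go N (λ i → f (2 + i))
  where
  go : ∀ N (g : ℕ → ℕ) → sumᴸ (List.applyUpTo g N) ≡ ∑[ i < N ] g (toℕ i)
  go zero    g = refl
  go (suc N) g = cong (g 0 +_) (go N (g ∘ suc))

sum-δ : ∀ N {x} → x < N → (f : ℕ → ℕ) →
  ∑[ i < N ] (if does (x ≟ toℕ i) then f (toℕ i) else 0) ≡ f x
sum-δ (suc N) {zero}  _         f =
  trans (cong (f 0 +_) (sum-replicate-zero N)) (ℕₚ.+-identityʳ (f 0))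
sum-δ (suc N) {suc x} (s≤s x<N) f = sum-δ N x<N (f ∘ suc)

-- Both sides count the pairs (i, j) with q j = 2 + i, each with weight 2 + i; the index i runs from
-- 0, the values of q from 2.
sum-by-value : (s : ℕ → ℕ) (N : ℕ) → (∀ i → N ≤ i → s (2 + i) ≡ 0) → (q : Fin n → ℕ) →
  (∀ j → 2 ≤ q j) → (∀ i → 2 ≤ i → ∣ ⟦ (λ j → q j ≟ i) ⟧ ∣ ≡ s i) →
  Σ[2+ N ] (λ i → i * s i) ≡ sum q
sum-by-value {n} s N s-finite q 2≤q fibre = begin
  Σ[2+ N ] (λ i → i * s i)
    ≡⟨ Σ[2+]≡sum N (λ i → i * s i) ⟩
  ∑[ i < N ] ((2 + toℕ i) * s (2 + toℕ i))
    ≡⟨ sum-cong-≗ {N} (λ i → fibre-sum (toℕ i)) ⟩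
  ∑[ i < N ] ∑[ j < n ] (if does (q j ≟ 2 + toℕ i) then 2 + toℕ i else 0)
    ≡⟨ ∑-comm (λ (i : Fin N) j → if does (q j ≟ 2 + toℕ i) then 2 + toℕ i else 0) ⟩
  ∑[ j < n ] ∑[ i < N ] (if does (q j ≟ 2 + toℕ i) then 2 + toℕ i else 0)
    ≡⟨ sum-cong-≗ single ⟩
  sum q ∎
  where
  open ≡-Reasoning
  fibre-sum : ∀ i → (2 + i) * s (2 + i) ≡ ∑[ j < n ] (if does (q j ≟ 2 + i) then 2 + i else 0)
  fibre-sum i = begin
    (2 + i) * s (2 + i)
      ≡⟨ cong ((2 + i) *_) (trans (sym (fibre (2 + i) (s≤s (s≤s z≤n)))) (∣⟦⟧∣ (λ j → q j ≟ 2 + i))) ⟩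
    (2 + i) * ∑[ j < n ] (if does (q j ≟ 2 + i) then 1 else 0)
      ≡⟨ *-distribˡ-sum (2 + i) (λ j → if does (q j ≟ 2 + i) then 1 else 0) ⟩
    ∑[ j < n ] ((2 + i) * (if does (q j ≟ 2 + i) then 1 else 0))
      ≡⟨ sum-cong-≗ (λ j → scale (does (q j ≟ 2 + i))) ⟩
    ∑[ j < n ] (if does (q j ≟ 2 + i) then 2 + i else 0) ∎
    where
    scale : ∀ b → (2 + i) * (if b then 1 else 0) ≡ (if b then 2 + i else 0)
    scale true  = ℕₚ.*-identityʳ (2 + i)
    scale false = ℕₚ.*-zeroʳ (2 + i)

  -- The value q j is taken at j itself, so s does not vanish there.
  q<2+N : ∀ j → q j < 2 + N
  q<2+N j = ℕₚ.≰⇒> λ 2+N≤q → ℕₚ.<⇒≱ (nonempty-fibre j)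
    (ℕₚ.≤-reflexive (trans (fibre (q j) (2≤q j))
      (subst (λ x → s x ≡ 0) (ℕₚ.m+[n∸m]≡n (2≤q j))
        (s-finite (q j ∸ 2) (ℕₚ.∸-monoˡ-≤ 2 2+N≤q)))))
    where
    nonempty-fibre : ∀ j → 0 < ∣ ⟦ (λ j′ → q j′ ≟ q j) ⟧ ∣
    nonempty-fibre j = subst (_≤ ∣ ⟦ (λ j′ → q j′ ≟ q j) ⟧ ∣) (∣⁅x⁆∣≡1 j) (p⊆q⇒∣p∣≤∣q∣ λ j′∈ →
      ∈-⟦⟧⁺ (λ j′ → q j′ ≟ q j) (cong q (x∈⁅y⁆⇒x≡y j j′∈)))

  single : ∀ j → ∑[ i < N ] (if does (q j ≟ 2 + toℕ i) then 2 + toℕ i else 0) ≡ q j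
  single j with q j | 2≤q j | q<2+N j
  ... | suc (suc x) | s≤s (s≤s _) | s≤s (s≤s x<N) = sum-δ N x<N (2 +_)

-- Subtracting 1 for each of the n girls turns (c) into the balance of boys and wanted husbands that
-- Hall's theorem requires.
sum-q∸1 : (q : Fin n → ℕ) → (∀ j → 2 ≤ q j) → m + n ≡ sum q → sum (λ j → q j ∸ 1) ≡ m
sum-q∸1 {n} {m} q 2≤q eq = ℕₚ.+-cancelʳ-≡ n _ _ (begin
  sum (λ j → q j ∸ 1) + n
    ≡⟨ cong (sum (λ j → q j ∸ 1) +_) (trans (sum-const n 1) (ℕₚ.*-identityʳ n)) ⟨
  sum (λ j → q j ∸ 1) + ∑[ j < n ] 1
    ≡⟨ ∑-distrib-+ (λ j → q j ∸ 1) (const 1) ⟨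
  sum (λ j → q j ∸ 1 + 1)
    ≡⟨ sum-cong-≗ (λ j → ℕₚ.m∸n+n≡m (ℕₚ.<⇒≤ (2≤q j))) ⟩
  sum q ≡⟨ eq ⟨
  m + n ∎)
  where open ≡-Reasoning

-- Transitivity of the long cycle

module _ .{{_ : NonZero k}} (π : Permutation′ k) (long : IsLongCycle π) where

  toℕ-iterate-long : ∀ t a → toℕ (iterate (π ⟨$⟩ʳ_) a t) ≡ (toℕ a + t) % k
  toℕ-iterate-long zero    a = sym (trans (cong (_% k) (ℕₚ.+-identityʳ (toℕ a)))
    (m<n⇒m%n≡m (Finₚ.toℕ<n a)))
  toℕ-iterate-long (suc t) a = begin
    toℕ (iterate (π ⟨$⟩ʳ_) (π ⟨$⟩ʳ a) t)        ≡⟨ toℕ-iterate-long t (π ⟨$⟩ʳ a) ⟩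
    (toℕ (π ⟨$⟩ʳ a) + t) % k                    ≡⟨ cong (λ x → (x + t) % k) (long a) ⟩
    (suc (toℕ a) % k + t) % k                   ≡⟨ %-distribˡ-+ (suc (toℕ a) % k) t k ⟩
    (suc (toℕ a) % k % k + t % k) % k           ≡⟨ cong (λ x → (x + t % k) % k) (m%n%n≡m%n (suc (toℕ a)) k) ⟩
    (suc (toℕ a) % k + t % k) % k               ≡⟨ %-distribˡ-+ (suc (toℕ a)) t k ⟨
    (suc (toℕ a) + t) % k                       ≡⟨ cong (_% k) (ℕₚ.+-suc (toℕ a) t) ⟨
    (toℕ a + suc t) % k                         ∎
    where open ≡-Reasoning

  long-cycle-induction : ∀ {p} (P : Pred (Fin k) p) → (∀ {a} → P a → P (π ⟨$⟩ʳ a)) →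
    ∀ {a} → P a → ∀ b → P b
  long-cycle-induction P step {a} Pa b =
    -- From a, k - a steps wrap around to 0 and b more lead to b, whichever of a and b is larger.
    subst P (Finₚ.toℕ-injective reach) (along (k ∸ toℕ a + toℕ b) Pa)
    where
    open ≡-Reasoning
    along : ∀ t {c} → P c → P (iterate (π ⟨$⟩ʳ_) c t)
    along zero    Pc = Pc
    along (suc t) Pc = along t (step Pc)

    reach : toℕ (iterate (π ⟨$⟩ʳ_) a (k ∸ toℕ a + toℕ b)) ≡ toℕ b
    reach = begin
      toℕ (iterate (π ⟨$⟩ʳ_) a (k ∸ toℕ a + toℕ b)) ≡⟨ toℕ-iterate-long _ a ⟩
      (toℕ a + (k ∸ toℕ a + toℕ b)) % k  ≡⟨ cong (_% k) (ℕₚ.+-assoc (toℕ a) (k ∸ toℕ a) (toℕ b)) ⟨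
      (toℕ a + (k ∸ toℕ a) + toℕ b) % k  ≡⟨ cong (λ x → (x + toℕ b) % k) (ℕₚ.m+[n∸m]≡n (ℕₚ.<⇒≤ (Finₚ.toℕ<n a))) ⟩
      (k + toℕ b) % k                    ≡⟨ cong (_% k) (ℕₚ.+-comm k (toℕ b)) ⟩
      (toℕ b + k) % k                    ≡⟨ [m+n]%n≡m%n (toℕ b) k ⟩
      toℕ b % k                          ≡⟨ m<n⇒m%n≡m (Finₚ.toℕ<n b) ⟩
      toℕ b                              ∎

somePoint : .{{_ : NonZero k}} → Fin k
somePoint {suc _} = zero

-- Eventual bounds and approximation errors

Eventually : (ℕ → Set) → Set
Eventually P = ∃[ N ] ∀ t → N ≤ t → P t

eventually-× : ∀ {P Q} → Eventually P → Eventually Q → Eventually (λ t → P t × Q t)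
eventually-× (M , p) (N , q) = M ⊔ N , λ t M⊔N≤t →
  p t (ℕₚ.m⊔n≤o⇒m≤o M N M⊔N≤t) , q t (ℕₚ.m⊔n≤o⇒n≤o M N M⊔N≤t)

eventually-∀ : {P : Fin n → ℕ → Set} → (∀ i → Eventually (P i)) →
  Eventually (λ t → ∀ i → P i t)
eventually-∀ {zero}  ev = 0 , λ t _ ()
eventually-∀ {suc n} ev with eventually-× (ev zero) (eventually-∀ (ev ∘ suc))
... | N , p = N , λ t N≤t → λ where
  zero    → proj₁ (p t N≤t)
  (suc i) → proj₂ (p t N≤t) i

∣p-q∣<δ⇒p≤q+δ : ∀ p q {δ} → ℚ.∣ p ℚ.- q ∣ ℚ.< δ → p ℚ.≤ q ℚ.+ δ
∣p-q∣<δ⇒p≤q+δ p q {δ} lt = begin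
  p                           ≡⟨ ℚₚ.+-identityʳ p ⟨
  p ℚ.+ 0ℚ                    ≡⟨ cong (p ℚ.+_) (ℚₚ.+-inverseˡ q) ⟨
  p ℚ.+ (ℚ.- q ℚ.+ q)         ≡⟨ ℚₚ.+-assoc p (ℚ.- q) q ⟨
  p ℚ.- q ℚ.+ q               ≤⟨ ℚₚ.+-monoˡ-≤ q (p≤∣p∣ (p ℚ.- q)) ⟩
  ℚ.∣ p ℚ.- q ∣ ℚ.+ q         ≤⟨ ℚₚ.+-monoˡ-≤ q (ℚₚ.<⇒≤ lt) ⟩
  δ ℚ.+ q                     ≡⟨ ℚₚ.+-comm δ q ⟩
  q ℚ.+ δ                     ∎
  where
  open ℚₚ.≤-Reasoning
  p≤∣p∣ : ∀ p → p ℚ.≤ ℚ.∣ p ∣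
  p≤∣p∣ p with ℚₚ.≤-total 0ℚ p
  ... | inj₁ 0≤p = ℚₚ.≤-reflexive (sym (ℚₚ.0≤p⇒∣p∣≡p 0≤p))
  ... | inj₂ p≤0 = ℚₚ.≤-trans p≤0 (ℚₚ.0≤∣p∣ p)

∣p-q∣<δ⇒q≤p+δ : ∀ p q {δ} → ℚ.∣ p ℚ.- q ∣ ℚ.< δ → q ℚ.≤ p ℚ.+ δ
∣p-q∣<δ⇒q≤p+δ p q {δ} lt = ∣p-q∣<δ⇒p≤q+δ q p (subst (ℚ._< δ) (begin
  ℚ.∣ p ℚ.- q ∣             ≡⟨ ℚₚ.∣-p∣≡∣p∣ (p ℚ.- q) ⟨
  ℚ.∣ ℚ.- (p ℚ.- q) ∣       ≡⟨ cong ℚ.∣_∣ (⁻¹-anti-homo-// p q) ⟩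
  ℚ.∣ q ℚ.- p ∣             ∎) lt)
  where open ≡-Reasoning

-- The bipartite graph of intersecting cycles

module _ (σ₁ σ₂ : Permutation′ k) where

  met : C σ₁ → Subset ∣C σ₂ ∣
  met i = ⟦ intersect? σ₁ σ₂ i ⟧

  meeting : C σ₂ → Subset ∣C σ₁ ∣
  meeting j = ⟦ (λ i → intersect? σ₁ σ₂ i j) ⟧

  -- The column sums of the system filter by `meeting j`, while the matrix `z` below is masked by
  -- `met i`; the two masks have to be identified.
  does-∈-meeting : ∀ i j → does (i ∈? meeting j) ≡ does (j ∈? met i)
  does-∈-meeting i j = begin
    does (i ∈? meeting j)          ≡⟨ does-∈? i (meeting j) ⟩
    Vec.lookup (meeting j) i       ≡⟨ Vecₚ.lookup∘tabulate (λ i → does (intersect? σ₁ σ₂ i j)) i ⟩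
    does (intersect? σ₁ σ₂ i j)    ≡⟨ Vecₚ.lookup∘tabulate (λ j → does (intersect? σ₁ σ₂ i j)) j ⟨
    Vec.lookup (met i) j           ≡⟨ does-∈? j (met i) ⟨
    does (j ∈? met i)              ∎
    where open ≡-Reasoning

  common⇒∈met : ∀ {a i j} → a ∈ support σ₁ i → a ∈ support σ₂ j → j ∈ met i
  common⇒∈met a∈i a∈j = ∈-⟦⟧⁺ (intersect? σ₁ σ₂ _) (_ , x∈p∩q⁺ (a∈i , a∈j))

  ∈met⇒common : ∀ {i j} → j ∈ met i → ∃[ a ] a ∈ support σ₁ i × a ∈ support σ₂ j
  ∈met⇒common j∈ with a , a∈ ← ∈-⟦⟧⁻ (intersect? σ₁ σ₂ _) j∈ = a , x∈p∩q⁻ _ _ a∈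

  met-cycleThrough : ∀ a → cycleThrough σ₂ a ∈ met (cycleThrough σ₁ a)
  met-cycleThrough a = common⇒∈met (∈-cycleThrough σ₁ a) (∈-cycleThrough σ₂ a)

  met-inhabited : ∀ i → Nonempty (met i)
  met-inhabited i with a , a∈i ← support-nonempty σ₁ i =
    cycleThrough σ₂ a , common⇒∈met a∈i (∈-cycleThrough σ₂ a)

  ∈-⋃C⁺ : ∀ {A j a} → j ∈ A → a ∈ support σ₂ j → a ∈ ⋃C σ₂ A
  ∈-⋃C⁺ {A} {j} {a} j∈A a∈j = ∈-⋃⁺ (Anyₚ.map⁺ (Any.map
    (λ { refl → a∈j }) (ListMemₚ.∈-filter⁺ (_∈? A) (ListMemₚ.∈-allFin j) j∈A)))

  ∈-⋃C⁻ : ∀ {A a} → a ∈ ⋃C σ₂ A → ∃[ j ] j ∈ A × a ∈ support σ₂ j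
  ∈-⋃C⁻ {A} a∈ with j , j∈ , a∈j ← ListMem.find (Anyₚ.map⁻ (∈-⋃⁻ _ a∈)) =
    j , proj₂ (ListMemₚ.∈-filter⁻ (_∈? A) {xs = List.allFin _} j∈) , a∈j

  boysMeeting≡neighbours : ∀ A → boysMeeting σ₁ σ₂ A ≡ neighbours met A
  boysMeeting≡neighbours A = ⟦⟧-cong
    {P? = λ i → nonempty? (support σ₁ i ∩ ⋃C σ₂ A)} {Q? = λ i → nonempty? (met i ∩ A)}
    (λ (a , a∈) → let a∈i , a∈⋃ = x∈p∩q⁻ _ _ a∈ ; j , j∈A , a∈j = ∈-⋃C⁻ a∈⋃ in
      j , x∈p∩q⁺ (common⇒∈met a∈i a∈j , j∈A))
    (λ (j , j∈) → let j∈met , j∈A = x∈p∩q⁻ _ _ j∈ ; a , a∈i , a∈j = ∈met⇒common j∈met in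
      a , x∈p∩q⁺ (a∈i , ∈-⋃C⁺ j∈A a∈j))

  -- Otherwise ⋃ A would be invariant under σ₂ and σ₁, hence under the long cycle.
  crossing : .{{_ : NonZero k}} → IsLongCycle (σ₁ ∘ᵖ σ₂) → ∀ A → A ≢ ⊥ → A ≢ ⊤ →
    ∃₂ λ i j → i ∈ neighbours met A × j ∉ A × j ∈ met i
  crossing long A A≢⊥ A≢⊤ with Finₚ.any? (λ i → Finₚ.any? (λ j →
      (i ∈? neighbours met A) ×-dec (¬? (j ∈? A) ×-dec (j ∈? met i))))
  ... | yes (i , j , found) = i , j , found
  ... | no  ∄ = contradiction (⊆-antisym (⊆-max A) (λ {j} _ → all∈A j)) A≢⊤
    where
    P : Fin k → Set
    P a = cycleThrough σ₂ a ∈ A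

    confined : ∀ {i j} → i ∈ neighbours met A → j ∈ met i → j ∈ A
    confined {i} {j} i∈N j∈i =
      decidable-stable (j ∈? A) λ j∉A → ∄ (i , j , i∈N , j∉A , j∈i)

    σ₁-closed : ∀ {a} → P a → P (σ₁ ⟨$⟩ʳ a)
    σ₁-closed {a} Pa = confined (∈-neighbours⁺ met (met-cycleThrough a) Pa)
      (common⇒∈met (support-closed σ₁ (∈-cycleThrough σ₁ a)) (∈-cycleThrough σ₂ (σ₁ ⟨$⟩ʳ a)))

    σ₂-closed : ∀ {a} → P a → P (σ₂ ⟨$⟩ʳ a)
    σ₂-closed {a} = subst (_∈ A)
      (cycleThrough-unique σ₂ (support-closed σ₂ (∈-cycleThrough σ₂ a)))

    start : ∃[ a ] P a
    start with nonempty? A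
    ... | no  empty     = contradiction (Empty-unique empty) A≢⊥
    ... | yes (j , j∈A) with a , a∈j ← support-nonempty σ₂ j =
      a , subst (_∈ A) (cycleThrough-unique σ₂ a∈j) j∈A

    all∈A : ∀ j → j ∈ A
    all∈A j with a , a∈j ← support-nonempty σ₂ j =
      subst (_∈ A) (sym (cycleThrough-unique σ₂ a∈j))
        (long-cycle-induction (σ₁ ∘ᵖ σ₂) long P (σ₁-closed ∘ σ₂-closed) (proj₂ start) a)

  module _ (q : C σ₂ → ℕ) where

    w : C σ₂ → ℕ
    w j = q j ∸ 1

    e⇒strict : Condition-e σ₁ σ₂ q → StrictHall w met
    e⇒strict e A A≢⊥ A≢⊤ =
      subst₂ _<_ (sum-elements w A) (cong ∣_∣ (boysMeeting≡neighbours A)) (e A A≢⊥ A≢⊤)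

    strict⇒e : StrictHall w met → Condition-e σ₁ σ₂ q
    strict⇒e strict A A≢⊥ A≢⊤ =
      subst₂ _<_ (sym (sum-elements w A)) (sym (cong ∣_∣ (boysMeeting≡neighbours A)))
        (strict A A≢⊥ A≢⊤)

    arranges⇒arrangement : ∀ {M} → Arranges w met M → IsArrangement σ₁ σ₂ q M
    arranges⇒arrangement (M∈ , fibres) = record
      { intersecting = λ i → ∈-⟦⟧⁻ (intersect? σ₁ σ₂ i) (M∈ i)
      ; husbands     = fibres
      }

    arrangement⇒arranges : ∀ {M} → IsArrangement σ₁ σ₂ q M → Arranges w met M
    arrangement⇒arranges ar =
      (λ i → ∈-⟦⟧⁺ (intersect? σ₁ σ₂ i) (intersecting i)) , husbands
      where open IsArrangement ar

    e²⇒e : Condition-e² σ₁ σ₂ q → Condition-e σ₁ σ₂ q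
    e²⇒e e² = strict⇒e λ A A≢⊥ A≢⊤ →
      let _ , _ , ar₁ , ar₂ , ≢ = e² A A≢⊥ A≢⊤ in
      two-arrangements⇒strict w met (arrangement⇒arranges ar₁) (arrangement⇒arranges ar₂) A ≢

    e³⇒e : .{{_ : NonZero k}} → IsLongCycle (σ₁ ∘ᵖ σ₂) →
      Condition-e³ σ₁ σ₂ q → Condition-e σ₁ σ₂ q
    e³⇒e long (x , sol) = strict⇒e λ A A≢⊥ A≢⊤ →
      let i₀ , j₀ , i₀∈N , j₀∉A , j₀∈i₀ = crossing long A A≢⊥ A≢⊤
          ε , 0<ε , ε<x = positive i₀ j₀ (∈-⟦⟧⁻ (intersect? σ₁ σ₂ i₀) j₀∈i₀)
          -- One error δ per row and per column: together they must stay below ε, the lower bound of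
          -- the crossing entry.
          δ , 0<δ , Σδ<ε = archimedean (∣C σ₁ ∣ + ∣C σ₂ ∣) 0<ε
          -- Finitely many eventual bounds hold jointly from T on, and the rational values at the
          -- single index T suffice.
          T , close = eventually-× ε<x (eventually-× nonneg
            (eventually-× (eventually-∀ λ i → rows i δ 0<δ)
                          (eventually-∀ λ j → columns j δ 0<δ)))
          ε<z , z≥0 , row≈ , col≈ = close T ℕₚ.≤-refl
      in approximate-solution⇒strict w met (z T) (ℚₚ.<⇒≤ 0<δ) Σδ<ε
           z≥0 (z-vanishes T)
           (λ i → ∣p-q∣<δ⇒p≤q+δ (ℚΣ.sum (z T i)) 1ℚ
             (subst (λ r → ℚ.∣ r ℚ.- 1ℚ ∣ ℚ.< δ) (row-sum T i) (row≈ i)))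
           (λ j → ∣p-q∣<δ⇒q≤p+δ (ℚΣ.sum (λ i → z T i j)) (ι (w j))
             (subst (λ r → ℚ.∣ r ℚ.- ι (w j) ∣ ℚ.< δ) (column-sum T j) (col≈ j)))
           (subst (ε ℚ.≤_) (sym (z-met T j₀∈i₀)) (ℚₚ.<⇒≤ ε<z)) i₀∈N j₀∉A
      where
      open IsPositiveSolution sol

      z : ℕ → C σ₁ → C σ₂ → ℚ
      -- Values of x at pairs that do not intersect are unconstrained, so they are replaced by 0.
      z t i j = if does (j ∈? met i) then approx (x i j) t else 0ℚ

      z-met : ∀ t {i j} → j ∈ met i → z t i j ≡ approx (x i j) t
      z-met t {i} {j} j∈i rewrite dec-true (j ∈? met i) j∈i = refl

      z-vanishes : ∀ t i j → j ∉ met i → z t i j ≡ 0ℚ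
      z-vanishes t i j j∉i rewrite dec-false (j ∈? met i) j∉i = refl

      nonneg : Eventually (λ t → ∀ i j → 0ℚ ℚ.≤ z t i j)
      nonneg = eventually-∀ λ i → eventually-∀ λ j → entry i j
        where
        entry : ∀ i j → Eventually (λ t → 0ℚ ℚ.≤ z t i j)
        entry i j with j ∈? met i
        ... | no  _   = 0 , λ _ _ → ℚₚ.≤-refl
        ... | yes j∈i with ε , 0<ε , N , ε<x ← positive i j (∈-⟦⟧⁻ (intersect? σ₁ σ₂ i) j∈i) =
          N , λ t N≤t → ℚₚ.<⇒≤ (ℚₚ.<-trans 0<ε (ε<x t N≤t))

      row-sum : ∀ t i → approx (sumℝ (List.map (x i) (elements (met i)))) t ≡ ℚΣ.sum (z t i)
      row-sum t i = sumℝ-elements (x i) (met i) t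

      column-sum : ∀ t j →
        approx (sumℝ (List.map (λ i → x i j) (elements (meeting j)))) t ≡
        ℚΣ.sum (λ i → z t i j)
      column-sum t j = trans (sumℝ-elements (λ i → x i j) (meeting j) t)
        (ℚΣ.sum-cong-≗ λ i →
          cong (if_then approx (x i j) t else 0ℚ) (does-∈-meeting i j))

    e⇒e² : .{{_ : NonZero k}} → sum w ≡ ∣C σ₁ ∣ →
      Condition-e σ₁ σ₂ q → Condition-e² σ₁ σ₂ q
    e⇒e² total e A A≢⊥ A≢⊤ =
      let M₁ , M₂ , ar₁ , ar₂ , ≢ = strict⇒two-arrangements w met total met-inhabited
            (e⇒strict e) (cycleThrough σ₁ somePoint) A A≢⊥ A≢⊤
      in M₁ , M₂ , arranges⇒arrangement ar₁ , arranges⇒arrangement ar₂ , ≢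

    module _ .{{_ : NonZero k}} (M : Fin k → C σ₁ → C σ₂)
      (arranges : ∀ a → Arranges w met (M a))
      (covers : ∀ i j → j ∈ met i → ∃[ a ] M a i ≡ j) where

      private
        Y : C σ₁ → C σ₂ → ℕ
        Y = marriages w met M arranges

        c : ℚ
        c = proj₁ (recip k)

        0<c : 0ℚ ℚ.< c
        0<c = proj₁ (proj₂ (recip k))

        kc≡1 : ι k ℚ.* c ≡ 1ℚ
        kc≡1 = proj₂ (proj₂ (recip k))

        x : C σ₁ → C σ₂ → ℝ
        x i j = fromℚ (ι (Y i j) ℚ.* c)

        instance
          c-pos : ℚ.Positive c
          c-pos = ℚ.positive 0<c

        x-positive : ∀ i j → Intersect σ₁ σ₂ i j → Positive (x i j)
        x-positive i j meet =
          let a , Mai≡j   = covers i j (∈-⟦⟧⁺ (intersect? σ₁ σ₂ i) meet)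
              -- Each intersecting pair is married at least once, so x i j ≥ c; `Positive` wants a
              -- strict lower bound, hence some ε below c.
              ε , 0<ε , ε<c = archimedean 1 0<c
          in ε , 0<ε , 0 , λ _ _ → ℚₚ.<-≤-trans
            (subst (ℚ._< c) (ℚₚ.*-identityˡ ε) ε<c)
            (subst (ℚ._≤ ι (Y i j) ℚ.* c) (ℚₚ.*-identityˡ c)
              (ℚₚ.*-monoʳ-≤-nonNeg c {{ℚₚ.pos⇒nonNeg c}}
                (ι-mono-≤ (marriages-pos w met M arranges Mai≡j))))

        x-rows : ∀ i → sumℝ (List.map (x i) (elements (met i))) ≈ fromℕ 1
        x-rows i = pointwise⇒≈ (sumℝ (List.map (x i) (elements (met i)))) (fromℕ 1) λ t → begin
          approx (sumℝ (List.map (x i) (elements (met i)))) t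
            ≡⟨ sumℝ-scaled (Y i) c (met i) t ⟩
          ι (weight (Y i) (met i)) ℚ.* c
            ≡⟨ cong (λ y → ι y ℚ.* c) (trans
                 (weight-supported (Y i) (met i) (λ j → marriages-vanish w met M arranges))
                 (marriages-row w met M arranges i)) ⟩
          ι k ℚ.* c ≡⟨ kc≡1 ⟩
          1ℚ        ∎
          where open ≡-Reasoning

        x-columns : ∀ j →
          sumℝ (List.map (λ i → x i j) (elements (meeting j))) ≈ fromℕ (w j)
        x-columns j = pointwise⇒≈
          (sumℝ (List.map (λ i → x i j) (elements (meeting j)))) (fromℕ (w j)) λ t → begin
          approx (sumℝ (List.map (λ i → x i j) (elements (meeting j)))) t
            ≡⟨ sumℝ-scaled (λ i → Y i j) c (meeting j) t ⟩
          ι (weight (λ i → Y i j) (meeting j)) ℚ.* c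
            ≡⟨ cong (λ y → ι y ℚ.* c) (trans
                 (weight-supported (λ i → Y i j) (meeting j)
                   (λ i i∉ → marriages-vanish w met M arranges λ j∈ → i∉
                     (∈-⟦⟧⁺ (λ i → intersect? σ₁ σ₂ i j) (∈-⟦⟧⁻ (intersect? σ₁ σ₂ i) j∈))))
                 (marriages-column w met M arranges j)) ⟩
          ι (k * w j) ℚ.* c         ≡⟨ cong (λ y → ι y ℚ.* c) (ℕₚ.*-comm k (w j)) ⟩
          ι (w j * k) ℚ.* c         ≡⟨ cong (ℚ._* c) (ι-* (w j) k) ⟩
          ι (w j) ℚ.* ι k ℚ.* c     ≡⟨ ℚₚ.*-assoc (ι (w j)) (ι k) c ⟩
          ι (w j) ℚ.* (ι k ℚ.* c)   ≡⟨ cong (ι (w j) ℚ.*_) kc≡1 ⟩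
          ι (w j) ℚ.* 1ℚ            ≡⟨ ℚₚ.*-identityʳ (ι (w j)) ⟩
          ι (w j)                   ∎
          where open ≡-Reasoning

      average-solution : Condition-e³ σ₁ σ₂ q
      average-solution = x , record
        { positive = x-positive ; rows = x-rows ; columns = x-columns }

    -- The points of {1, …, k} label the pairs of intersecting cycles, so it suffices
    -- to average over them one arrangement through each pair.
    e⇒e³ : .{{_ : NonZero k}} → sum w ≡ ∣C σ₁ ∣ →
      Condition-e σ₁ σ₂ q → Condition-e³ σ₁ σ₂ q
    e⇒e³ total e = average-solution M (λ a → proj₁ (proj₂ (arrangement a))) covers
      where
      arrangement : ∀ a → ∃[ M ] Arranges w met M × M (cycleThrough σ₁ a) ≡ cycleThrough σ₂ a
      arrangement a =
        edge-arrangement w met total met-inhabited (e⇒strict e) (met-cycleThrough a)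

      M : Fin k → C σ₁ → C σ₂
      M a = proj₁ (arrangement a)

      covers : ∀ i j → j ∈ met i → ∃[ a ] M a i ≡ j
      covers i j j∈i =
        let a , a∈i , a∈j = ∈met⇒common j∈i in
        a , trans (cong (M a) (cycleThrough-unique σ₁ a∈i))
              (trans (proj₂ (proj₂ (arrangement a))) (sym (cycleThrough-unique σ₂ a∈j)))

proposition5 : (k : ℕ) .{{_ : NonZero k}}
    (s : ℕ → ℕ) (N : ℕ) → (∀ i → N ≤ i → s (2 + i) ≡ 0) →
    (σ₁ σ₂ : Permutation′ k) (q : C σ₂ → ℕ) →
    IsLongCycle (σ₁ ∘ᵖ σ₂) →
    ∣C σ₂ ∣ ≡ Σ[2+ N ] s →
    ∣C σ₁ ∣ + ∣C σ₂ ∣ ≡ Σ[2+ N ] (λ i → i * s i) →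
    (∀ j → 2 ≤ q j) →
    (∀ i → 2 ≤ i → ∣ ⟦ (λ j → q j ≟ i) ⟧ ∣ ≡ s i) →
    (Condition-e σ₁ σ₂ q ⇔ Condition-e² σ₁ σ₂ q) ×
    (Condition-e σ₁ σ₂ q ⇔ Condition-e³ σ₁ σ₂ q)
proposition5 k s N s-finite σ₁ σ₂ q long _ ∣C∣+∣C∣≡ 2≤q fibre =
  mk⇔ (e⇒e² σ₁ σ₂ q total) (e²⇒e σ₁ σ₂ q) ,
  mk⇔ (e⇒e³ σ₁ σ₂ q total) (e³⇒e σ₁ σ₂ q long)
  where
  total : sum (λ j → q j ∸ 1) ≡ ∣C σ₁ ∣
  total = sum-q∸1 q 2≤q (trans ∣C∣+∣C∣≡ (sum-by-value s N s-finite q 2≤q fibre))
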